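{- For any computably bounded numbering $\phi$ and any positive integer constant $k$, there is no computable function $f:\mathbb{N}\to\mathbb{N}^k$ such that $\min_\phi(e)$ is one of the $k$ entries of $f(e)$ for all $e$.
   Context: A numbering $\phi$ is given by a partial-recursive function $U:\mathbb{N}^2\to\mathbb{N}$ via $\phi_e(x)=U(e,x)$. $\phi$ is computably bounded if for every numbering $\psi$ there is a computable $f$ such that for every $e$ some $j\le f(e)$ has $\phi_j=\psi_e$. $\mathrm{MIN}_\phi=\{e:(\forall j<e)\,[\phi_j\ne\phi_e]\}$ and $\min_\phi(e)$ is the unique $j\in\mathrm{MIN}_\phi$ with $\phi_j=\phi_e$. -}

module Defs where

open import Data.Nat using (ℕ; zero; suc; _≤_; _<_)
open import Data.Fin using (Fin)
open import Data.Vec using (Vec; []; _∷_; lookup)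
open import Data.Product using (Σ; _×_; ∃; _,_)
open import Function.Bundles using (_⇔_)
open import Relation.Nullary using (¬_)

data PR : ℕ → Set where
  zer  : ∀ {n} → PR n
  succ : PR 1
  proj : ∀ {n} → Fin n → PR n
  comp : ∀ {n m} → PR m → Vec (PR n) m → PR n
  prim : ∀ {n} → PR n → PR (suc (suc n)) → PR (suc n)
  mu   : ∀ {n} → PR (suc n) → PR n

data _⟦_⟧⇓_ : ∀ {n} → PR n → Vec ℕ n → ℕ → Set
data _⟦_⟧⇓*_ : ∀ {n m} → Vec (PR n) m → Vec ℕ n → Vec ℕ m → Set
data MuFrom : ∀ {n} → PR (suc n) → Vec ℕ n → ℕ → ℕ → Set

data _⟦_⟧⇓_ where
  zerE  : ∀ {n} {xs : Vec ℕ n} → zer ⟦ xs ⟧⇓ 0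
  succE : ∀ {x} → succ ⟦ x ∷ [] ⟧⇓ suc x
  projE : ∀ {n} {i : Fin n} {xs} → proj i ⟦ xs ⟧⇓ lookup xs i
  compE : ∀ {n m} {f : PR m} {gs : Vec (PR n) m} {xs ys y} →
          gs ⟦ xs ⟧⇓* ys → f ⟦ ys ⟧⇓ y → comp f gs ⟦ xs ⟧⇓ y
  primZ : ∀ {n} {g : PR n} {h xs y} →
          g ⟦ xs ⟧⇓ y → prim g h ⟦ 0 ∷ xs ⟧⇓ y
  primS : ∀ {n} {g : PR n} {h xs k a y} →
          prim g h ⟦ k ∷ xs ⟧⇓ a → h ⟦ k ∷ a ∷ xs ⟧⇓ y →
          prim g h ⟦ suc k ∷ xs ⟧⇓ y
  muE   : ∀ {n} {f : PR (suc n)} {xs y} → MuFrom f xs 0 y → mu f ⟦ xs ⟧⇓ y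

data _⟦_⟧⇓*_ where
  []  : ∀ {n} {xs : Vec ℕ n} → [] ⟦ xs ⟧⇓* []
  _∷_ : ∀ {n m} {g : PR n} {gs : Vec (PR n) m} {xs y ys} →
        g ⟦ xs ⟧⇓ y → gs ⟦ xs ⟧⇓* ys → (g ∷ gs) ⟦ xs ⟧⇓* (y ∷ ys)

data MuFrom where
  here  : ∀ {n} {f : PR (suc n)} {xs i} → f ⟦ i ∷ xs ⟧⇓ 0 → MuFrom f xs i i
  there : ∀ {n} {f : PR (suc n)} {xs i z y} →
          f ⟦ i ∷ xs ⟧⇓ suc z → MuFrom f xs (suc i) y → MuFrom f xs i y

Computable : (ℕ → ℕ) → Set
Computable f = Σ (PR 1) λ p → ∀ x → p ⟦ x ∷ [] ⟧⇓ f x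

ComputableVec : ∀ {k} → (ℕ → Vec ℕ k) → Set
ComputableVec {k} f = (i : Fin k) → Computable (λ x → lookup (f x) i)

-- A numbering is given by a partial recursive U : ℕ² → ℕ, with φ_e(x) = U(e,x).
Numbering : Set
Numbering = PR 2

SameFn : Numbering → ℕ → Numbering → ℕ → Set
SameFn φ j ψ e = ∀ x y → (φ ⟦ j ∷ x ∷ [] ⟧⇓ y) ⇔ (ψ ⟦ e ∷ x ∷ [] ⟧⇓ y)

ComputablyBounded : Numbering → Set
ComputablyBounded φ =
  (ψ : Numbering) → Σ (ℕ → ℕ) λ f → Computable f ×
    (∀ e → ∃ λ j → j ≤ f e × SameFn φ j ψ e)

InMIN : Numbering → ℕ → Set
InMIN φ e = ∀ j → j < e → ¬ SameFn φ j φ e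

-- "min_φ(e) = j" : j is the unique element of MIN_φ with φ_j = φ_e.
IsMinIndex : Numbering → ℕ → ℕ → Set
IsMinIndex φ e j = InMIN φ j × SameFn φ j φ e

{-# OPTIONS --safe #-}
module Submission where

-- φ itself serves as a universal machine: put ψ_⟨a,l⟩(x) = φ_a(⟨⟨a,l⟩,x⟩), let b bound φ-indices
-- for ψ, and let a be a φ-index of the strategy below, which thus knows a and hence the slots
-- (φ-indices ≤ b⟨a,l⟩) among which the functions of its finitely many tokens l must appear.
-- All tokens are zero functions on growing finite sets.  At each stage one token is active; the
-- strategy waits until a slot c shows exactly its current set, then acts at one of the levels
-- 0, …, k.  Level e plays rounds inside a subtree of level e + 1: each round has a base P and two
-- subtrees of tokens that extend P in turn; an odd action passes from the left subtree to the
-- right one, an even action ends the round by making everything played in it the next base.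
-- Say that a candidate of c counts at e if it shows a point outside the base of level e, but
-- none outside this base and the points played since the current subtree was started.  The sets
-- of candidates that count form an increasing chain of k + 2 subsets of the k candidates, so for
-- some e every candidate that counts at e + 1 counts at e; the strategy acts at such an e.
-- Let e be the highest level acting infinitely often.  The slots used infinitely often by its
-- actions all compute the same function E, so they share a minimal index m, which is one of their
-- candidates and counts at e + 1 from some stage on, hence also at e whenever e acts.  So at a
-- late odd action m shows a point of the left subtree outside P, and at the next even action it
-- has no such point: a contradiction.  If no level acts infinitely often, then the last active
-- token has no slot.

open import Defs
open import Data.Empty using (⊥; ⊥-elim)
open import Data.Fin using (Fin; zero; suc; toℕ)
import Data.Fin.Properties as Fin
open import Data.Nat hiding (parity)
open import Data.Nat.Properties
open import Data.Product using (Σ; ∃; ∃₂; _×_; _,_; proj₁; proj₂)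
open import Data.Sum using (_⊎_; inj₁; inj₂)
open import Data.Vec using (Vec; []; _∷_; head; lookup; map; tabulate; tail)
open import Data.Vec.Properties using (tabulate∘lookup)
open import Function using (_∘_; id)
open import Function.Bundles using (_⇔_; mk⇔; Equivalence)
open import Relation.Binary.Definitions using (tri<; tri≈; tri>)
open import Relation.Binary.PropositionalEquality
open import Relation.Nullary using (Dec; yes; no; ¬_)
open import Relation.Nullary.Decidable using (decidable-stable; map′; _×-dec_; _⊎-dec_; _→-dec_)

-- Total computable functions and decidable predicates

natrec : ℕ → (ℕ → ℕ → ℕ) → ℕ → ℕ
natrec z s zero    = z
natrec z s (suc n) = s n (natrec z s n)

record Comp {n} (f : Vec ℕ n → ℕ) : Set where
  constructor mkComp
  field
    code : PR n
    eval : ∀ ρ → code ⟦ ρ ⟧⇓ f ρ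
open Comp

record Comps {n m} (F : Vec ℕ n → Vec ℕ m) : Set where
  constructor mkComps
  field
    codes : Vec (PR n) m
    evals : ∀ ρ → codes ⟦ ρ ⟧⇓* F ρ
open Comps

private variable
  n m : ℕ
  f g h : Vec ℕ n → ℕ

comp-ext : (∀ ρ → f ρ ≡ g ρ) → Comp f → Comp g
comp-ext eq c .code   = code c
comp-ext eq c .eval ρ = subst (code c ⟦ ρ ⟧⇓_) (eq ρ) (eval c ρ)

comps-ext : {F G : Vec ℕ n → Vec ℕ m} → (∀ ρ → F ρ ≡ G ρ) → Comps F → Comps G
comps-ext eq c .codes   = codes c
comps-ext eq c .evals ρ = subst (codes c ⟦ ρ ⟧⇓*_) (eq ρ) (evals c ρ)

nil : Comps {n} (λ _ → [])
nil = mkComps [] (λ _ → [])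

infixr 5 _,,_
_,,_ : {G : Vec ℕ n → Vec ℕ m} → Comp f → Comps G → Comps (λ ρ → f ρ ∷ G ρ)
c ,, cs = mkComps (code c ∷ codes cs) (λ ρ → eval c ρ ∷ evals cs ρ)

_∘ᶜ_ : {f : Vec ℕ m → ℕ} {G : Vec ℕ n → Vec ℕ m} → Comp f → Comps G → Comp (f ∘ G)
c ∘ᶜ cs = mkComp (comp (code c) (codes cs)) (λ ρ → compE (evals cs ρ) (eval c _))

var : (i : Fin n) → Comp (λ ρ → lookup ρ i)
var i = mkComp (proj i) (λ _ → projE)

rename : (r : Fin m → Fin n) → Comps (λ ρ → tabulate (lookup ρ ∘ r))
rename {zero}  r = nil
rename {suc m} r = var (r zero) ,, rename (r ∘ suc)

id-comps : Comps {n} id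
id-comps = comps-ext tabulate∘lookup (rename id)

tail-comps : Comps {suc n} tail
tail-comps = comps-ext (λ { (x ∷ ρ) → tabulate∘lookup ρ }) (rename suc)

tail²-comps : Comps {suc (suc n)} (tail ∘ tail)
tail²-comps = comps-ext (λ { (x ∷ y ∷ ρ) → tabulate∘lookup ρ }) (rename (λ i → suc (suc i)))

wk : Comp f → Comp (λ ρ → f (tail ρ))
wk c = c ∘ᶜ tail-comps

head-comp : Comp {suc n} head
head-comp = comp-ext (λ { (x ∷ ρ) → refl }) (var zero)

comp-natrec : {b : Vec ℕ n → ℕ} → Comp g → Comp {suc (suc n)} h → Comp b →
  Comp (λ ρ → natrec (g ρ) (λ k a → h (k ∷ a ∷ ρ)) (b ρ))
comp-natrec {g = g} {h = h} cg ch cb = mkComp (prim (code cg) (code ch)) run ∘ᶜ (cb ,, id-comps)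
  where
  run′ : ∀ k ρ → prim (code cg) (code ch) ⟦ k ∷ ρ ⟧⇓ natrec (g ρ) (λ k a → h (k ∷ a ∷ ρ)) k
  run′ zero    ρ = primZ (eval cg ρ)
  run′ (suc k) ρ = primS (run′ k ρ) (eval ch _)
  run : ∀ ρ → prim (code cg) (code ch) ⟦ ρ ⟧⇓
              natrec (g (tail ρ)) (λ k a → h (k ∷ a ∷ tail ρ)) (head ρ)
  run (k ∷ ρ) = run′ k ρ

suc-comp : Comp f → Comp (λ ρ → suc (f ρ))
suc-comp c = mkComp {f = λ ρ → suc (head ρ)} succ (λ { (_ ∷ []) → succE }) ∘ᶜ (c ,, nil)

const-comp : ∀ c → Comp {n} (λ _ → c)
const-comp zero    = mkComp zer (λ _ → zerE)
const-comp (suc c) = suc-comp (const-comp c)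

pred-comp : Comp f → Comp (λ ρ → pred (f ρ))
pred-comp {f = f} c = comp-ext (λ ρ → lem (f ρ)) (comp-natrec (const-comp 0) (var zero) c)
  where
  lem : ∀ k → natrec 0 (λ k a → k) k ≡ pred k
  lem zero    = refl
  lem (suc k) = refl

+-comp : Comp f → Comp g → Comp (λ ρ → f ρ + g ρ)
+-comp {f = f} {g = g} cf cg =
  comp-ext (λ ρ → lem (g ρ) (f ρ)) (comp-natrec cg (suc-comp (var (suc zero))) cf)
  where
  lem : ∀ b k → natrec b (λ k a → suc a) k ≡ k + b
  lem b zero    = refl
  lem b (suc k) = cong suc (lem b k)

∸-comp : Comp f → Comp g → Comp (λ ρ → f ρ ∸ g ρ)
∸-comp {f = f} {g = g} cf cg =
  comp-ext (λ ρ → lem (f ρ) (g ρ)) (comp-natrec cf (pred-comp (var (suc zero))) cg)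
  where
  lem : ∀ b k → natrec b (λ k a → pred a) k ≡ b ∸ k
  lem b zero    = refl
  lem b (suc k) = trans (cong pred (lem b k)) (pred[m∸n]≡m∸[1+n] b k)

*-comp : Comp f → Comp g → Comp (λ ρ → f ρ * g ρ)
*-comp {f = f} {g = g} cf cg =
  comp-ext (λ ρ → lem (g ρ) (f ρ)) (comp-natrec (const-comp 0) (+-comp (wk (wk cg)) (var (suc zero))) cf)
  where
  lem : ∀ b k → natrec 0 (λ k a → b + a) k ≡ k * b
  lem b zero    = refl
  lem b (suc k) = cong (b +_) (lem b k)

⊔-comp : Comp f → Comp g → Comp (λ ρ → f ρ ⊔ g ρ)
⊔-comp {f = f} {g = g} cf cg =
  comp-ext (λ ρ → lem (f ρ) (g ρ)) (+-comp cf (∸-comp cg cf))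
  where
  lem : ∀ a b → a + (b ∸ a) ≡ a ⊔ b
  lem zero    b       = refl
  lem (suc a) zero    = cong suc (+-identityʳ a)
  lem (suc a) (suc b) = cong suc (lem a b)

-- The value 0 stands for truth: sums then give conjunctions, products give disjunctions, and `mu`
-- applied to `χ` searches for a witness.
record Rec {n} (P : Vec ℕ n → Set) : Set where
  constructor mkRec
  field
    χ        : Vec ℕ n → ℕ
    χ-comp   : Comp χ
    sound    : ∀ ρ → χ ρ ≡ 0 → P ρ
    complete : ∀ ρ → P ρ → χ ρ ≡ 0
open Rec

private variable
  P Q : Vec ℕ n → Set

rec-dec : Rec P → ∀ ρ → Dec (P ρ)
rec-dec r ρ = map′ (sound r ρ) (complete r ρ) (χ r ρ ≟ 0)

rec-≤ : Comp f → Comp g → Rec (λ ρ → f ρ ≤ g ρ)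
rec-≤ cf cg = mkRec _ (∸-comp cf cg) (λ ρ → m∸n≡0⇒m≤n) (λ ρ → m≤n⇒m∸n≡0)

rec-< : Comp f → Comp g → Rec (λ ρ → f ρ < g ρ)
rec-< cf cg = rec-≤ (suc-comp cf) cg

rec-× : Rec P → Rec Q → Rec (λ ρ → P ρ × Q ρ)
rec-× p q = mkRec _ (+-comp (χ-comp p) (χ-comp q))
  (λ ρ e → sound p ρ (m+n≡0⇒m≡0 _ e) , sound q ρ (m+n≡0⇒n≡0 (χ p ρ) e))
  (λ ρ (a , b) → cong₂ _+_ (complete p ρ a) (complete q ρ b))

rec-⇔ : (∀ ρ → P ρ → Q ρ) → (∀ ρ → Q ρ → P ρ) → Rec P → Rec Q
rec-⇔ to from p = mkRec _ (χ-comp p) (λ ρ e → to ρ (sound p ρ e)) (λ ρ q → complete p ρ (from ρ q))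

rec-≡ : Comp f → Comp g → Rec (λ ρ → f ρ ≡ g ρ)
rec-≡ cf cg = rec-⇔ (λ ρ (a , b) → ≤-antisym a b) (λ ρ e → ≤-reflexive e , ≤-reflexive (sym e))
  (rec-× (rec-≤ cf cg) (rec-≤ cg cf))

rec-¬ : Rec P → Rec (λ ρ → ¬ P ρ)
rec-¬ {P = P} p = mkRec _ (∸-comp (const-comp 1) (χ-comp p))
  (λ ρ e Pρ → case′ (trans (sym e) (cong (1 ∸_) (complete p ρ Pρ)))) back
  where
  case′ : 0 ≡ 1 → ⊥
  case′ ()
  back : ∀ ρ → ¬ P ρ → 1 ∸ χ p ρ ≡ 0
  back ρ ¬P with χ p ρ in eq
  ... | zero  = ⊥-elim (¬P (sound p ρ eq))
  ... | suc c = 0∸n≡0 c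

rec-⊎ : Rec P → Rec Q → Rec (λ ρ → P ρ ⊎ Q ρ)
rec-⊎ p q = mkRec _ (*-comp (χ-comp p) (χ-comp q)) to from
  where
  to : ∀ ρ → χ p ρ * χ q ρ ≡ 0 → _
  to ρ e with m*n≡0⇒m≡0∨n≡0 (χ p ρ) e
  ... | inj₁ a = inj₁ (sound p ρ a)
  ... | inj₂ b = inj₂ (sound q ρ b)
  from : ∀ ρ → _ → χ p ρ * χ q ρ ≡ 0
  from ρ (inj₁ a) = cong (_* χ q ρ) (complete p ρ a)
  from ρ (inj₂ b) = trans (cong (χ p ρ *_) (complete q ρ b)) (*-zeroʳ (χ p ρ))

rec-→ : Rec P → Rec Q → Rec (λ ρ → P ρ → Q ρ)
rec-→ p q = rec-⇔ to from (rec-⊎ (rec-¬ p) q)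
  where
  to : ∀ ρ → _ → _ → _
  to ρ (inj₁ ¬a) a = ⊥-elim (¬a a)
  to ρ (inj₂ b)  a = b
  from : ∀ ρ → _ → _
  from ρ imp with rec-dec p ρ
  ... | yes a = inj₂ (imp a)
  ... | no ¬a = inj₁ ¬a

rec-∀< : {P : Vec ℕ (suc n) → Set} → Comp f → Rec P → Rec (λ ρ → ∀ x → x < f ρ → P (x ∷ ρ))
rec-∀< {f = f} {P = P} cf p = mkRec _
  (comp-natrec (const-comp 0)
     (+-comp (var (suc zero)) (χ-comp p ∘ᶜ (var zero ,, tail²-comps))) cf)
  (λ ρ → to ρ (f ρ)) (λ ρ → from ρ (f ρ))
  where
  S : ∀ ρ → ℕ → ℕ
  S ρ = natrec 0 (λ k a → a + χ p (k ∷ ρ))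
  to : ∀ ρ b → S ρ b ≡ 0 → ∀ x → x < b → P (x ∷ ρ)
  to ρ (suc b) e x x<b with m≤n⇒m<n∨m≡n (≤-pred x<b)
  ... | inj₁ x<b′ = to ρ b (m+n≡0⇒m≡0 _ e) x x<b′
  ... | inj₂ refl = sound p _ (m+n≡0⇒n≡0 (S ρ b) e)
  from : ∀ ρ b → (∀ x → x < b → P (x ∷ ρ)) → S ρ b ≡ 0
  from ρ zero    all = refl
  from ρ (suc b) all = cong₂ _+_ (from ρ b (λ x x<b → all x (m≤n⇒m≤1+n x<b))) (complete p _ (all b ≤-refl))

∃< : ℕ → (ℕ → Set) → Set
∃< b P = ∃ λ x → x < b × P x

rec-∃< : {P : Vec ℕ (suc n) → Set} → Comp f → Rec P → Rec (λ ρ → ∃< (f ρ) (λ x → P (x ∷ ρ)))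
rec-∃< {f = f} {P = P} cf p = rec-⇔ (λ ρ → to ρ (f ρ)) (λ ρ (x , l , Px) all → all x l Px)
  (rec-¬ (rec-∀< cf (rec-¬ p)))
  where
  to : ∀ ρ b → ¬ (∀ x → x < b → ¬ P (x ∷ ρ)) → ∃< b (λ x → P (x ∷ ρ))
  to ρ zero    ¬all = ⊥-elim (¬all (λ x ()))
  to ρ (suc b) ¬all with rec-dec p (b ∷ ρ)
  ... | yes Pb = b , ≤-refl , Pb
  ... | no ¬Pb with to ρ b (λ all → ¬all (λ x x<b → step all x (m≤n⇒m<n∨m≡n (≤-pred x<b))))
    where
    step : (∀ x → x < b → ¬ P (x ∷ ρ)) → ∀ x → x < b ⊎ x ≡ b → ¬ P (x ∷ ρ)
    step all x (inj₁ l)    = all x l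
    step all x (inj₂ refl) = ¬Pb
  ... | x , l , Px = x , m≤n⇒m≤1+n l , Px

rec-∀Fin : ∀ {k} {P : Fin k → Vec ℕ n → Set} → (∀ i → Rec (P i)) → Rec (λ ρ → ∀ i → P i ρ)
rec-∀Fin {k = zero}  r = rec-⇔ (λ _ _ ()) (λ _ _ → refl) (rec-≡ (const-comp 0) (const-comp 0))
rec-∀Fin {k = suc k} {P = P} r =
  rec-⇔ to (λ _ all → all zero , all ∘ suc) (rec-× (r zero) (rec-∀Fin (r ∘ suc)))
  where
  to : ∀ ρ → P zero ρ × (∀ i → P (suc i) ρ) → ∀ i → P i ρ
  to ρ (a , b) zero    = a
  to ρ (a , b) (suc i) = b i

ifd : {A : Set} → Dec A → ℕ → ℕ → ℕ
ifd (yes _) x y = x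
ifd (no _)  x y = y

ifd-yes : {A : Set} (d : Dec A) {x y : ℕ} → A → ifd d x y ≡ x
ifd-yes (yes _) a = refl
ifd-yes (no ¬a) a = ⊥-elim (¬a a)

ifd-no : {A : Set} (d : Dec A) {x y : ℕ} → ¬ A → ifd d x y ≡ y
ifd-no (yes a) ¬a = ⊥-elim (¬a a)
ifd-no (no _)  ¬a = refl

-- The value depends only on the truth of `P`, so the term may use any decision procedure `d`, not
-- just the one obtained from `r`.
ifd-comp : Rec P → (d : ∀ ρ → Dec (P ρ)) → Comp f → Comp g → Comp (λ ρ → ifd (d ρ) (f ρ) (g ρ))
ifd-comp {P = P} {f = f} {g = g} r d cf cg =
  comp-ext lem (comp-natrec cf (wk (wk cg)) (χ-comp r))
  where
  lem : ∀ ρ → natrec (f ρ) (λ _ _ → g ρ) (χ r ρ) ≡ ifd (d ρ) (f ρ) (g ρ)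
  lem ρ with χ r ρ in eq | d ρ
  ... | zero  | yes _ = refl
  ... | suc c | no _  = refl
  ... | zero  | no ¬a = ⊥-elim (¬a (sound r ρ eq))
  ... | suc c | yes a with () ← trans (sym eq) (complete r ρ a)

opaque
  search : {A : ℕ → Set} → (∀ x → Dec (A x)) → ℕ → ℕ
  -- While no witness has been met, the accumulator equals the recursion counter, so each step tests
  -- the next number; a witness is kept. Without one the result is the bound.
  search d = natrec 0 (λ _ a → ifd (d a) a (suc a))

  search-spec : {A : ℕ → Set} (d : ∀ x → Dec (A x)) → ∀ b →
    (search d b < b × A (search d b)) ⊎ (search d b ≡ b × (∀ x → x < b → ¬ A x))
  search-spec d zero = inj₂ (refl , λ x ())
  search-spec {A} d (suc b) with search-spec d b
  search-spec {A} d (suc b) | inj₁ (l , a) with d (search d b)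
  ... | yes a′ = inj₁ (m≤n⇒m≤1+n l , a′)
  ... | no ¬a  = ⊥-elim (¬a a)
  search-spec {A} d (suc b) | inj₂ (e , none) rewrite e with d b
  ... | yes a = inj₁ (≤-refl , a)
  ... | no ¬a = inj₂ (refl , λ x x<b → step x (m≤n⇒m<n∨m≡n (≤-pred x<b)))
    where
    step : ∀ x → x < b ⊎ x ≡ b → ¬ A x
    step x (inj₁ l)    = none x l
    step x (inj₂ refl) = ¬a

  search-comp : {P : Vec ℕ (suc n) → Set} → Rec P → (d : ∀ ρ x → Dec (P (x ∷ ρ))) → Comp f →
    Comp (λ ρ → search (d ρ) (f ρ))
  search-comp {P = P} r d cf =
    comp-natrec (const-comp 0)
      (ifd-comp (mkRec _ (χ-comp r ∘ᶜ (var (suc zero) ,, tail²-comps)) (λ ρ → sound r _) (λ ρ → complete r _))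
        (λ ρ → d (tail (tail ρ)) (lookup ρ (suc zero)))
        (var (suc zero)) (suc-comp (var (suc zero))))
      cf

search-found : {A : ℕ → Set} (d : ∀ x → Dec (A x)) → ∀ {b} → ∃< b A → search d b < b × A (search d b)
search-found d {b} (x , l , a) with search-spec d b
... | inj₁ s          = s
... | inj₂ (_ , none) = ⊥-elim (none x l a)

-- Finite-stage approximations of partial recursive functions

-- The code 0 means undefined and `suc y` means the value `y`; this makes composition strict.
gate : ℕ → ℕ → ℕ
gate zero    y = 0
gate (suc _) y = y

gate-comp : Comp f → Comp g → Comp (λ ρ → gate (f ρ) (g ρ))
gate-comp {f = f} {g = g} cf cg =
  comp-ext (λ ρ → lem (g ρ) (f ρ)) (comp-natrec (const-comp 0) (wk (wk cg)) cf)
  where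
  lem : ∀ y k → natrec 0 (λ _ _ → y) k ≡ gate k y
  lem y zero    = refl
  lem y (suc k) = refl

all-defined : Vec ℕ m → ℕ
all-defined []       = 1
all-defined (v ∷ vs) = gate v (all-defined vs)

-- Encodes the state of a μ-search below n: 0 = no zero met so far, 1 = blocked on an
-- argument not yet evaluated, suc (suc i) = first zero at i.
μ-step : ℕ → ℕ → ℕ → ℕ
μ-step (suc a) v             n = suc a
μ-step zero    zero          n = 1
μ-step zero    (suc zero)    n = suc (suc n)
μ-step zero    (suc (suc v)) n = 0

-- stage p t ρ is 0 while p ⟦ ρ ⟧ has produced nothing with searches bounded by t, and
-- suc y once the value y is known.
stage  : PR n → ℕ → Vec ℕ n → ℕ
stages : Vec (PR n) m → ℕ → Vec ℕ n → Vec ℕ m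
μ-state : PR (suc n) → ℕ → Vec ℕ n → ℕ → ℕ

stage zer         t ρ       = 1
stage succ        t (x ∷ _) = suc (suc x)
stage (proj i)    t ρ       = suc (lookup ρ i)
stage (comp p ps) t ρ       = gate (all-defined (stages ps t ρ)) (stage p t (map pred (stages ps t ρ)))
stage (prim p q)  t (k ∷ ρ) = natrec (stage p t ρ) (λ i a → gate a (stage q t (i ∷ pred a ∷ ρ))) k
stage (mu p)      t ρ       = pred (μ-state p t ρ t)

stages []       t ρ = []
stages (p ∷ ps) t ρ = stage p t ρ ∷ stages ps t ρ

μ-state p t ρ = natrec 0 (λ i a → μ-step a (stage p t (i ∷ ρ)) i)

gate-suc : ∀ a {y z} → gate a y ≡ suc z → ∃ λ b → a ≡ suc b × y ≡ suc z
gate-suc (suc a) e = a , refl , e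

μ-searching : (p : PR (suc n)) → ∀ t ρ b → μ-state p t ρ b ≡ 0 →
  ∀ j → j < b → ∃ λ z → stage p t (j ∷ ρ) ≡ suc (suc z)
μ-searching p t ρ (suc b) e j j<b
  with μ-state p t ρ b in eq | stage p t (b ∷ ρ) in eq′ | m≤n⇒m<n∨m≡n (≤-pred j<b)
... | zero | suc (suc z) | inj₁ l    = μ-searching p t ρ b eq j l
... | zero | suc (suc z) | inj₂ refl = z , eq′

μ-found : (p : PR (suc n)) → ∀ t ρ b i → μ-state p t ρ b ≡ suc (suc i) →
  i < b × stage p t (i ∷ ρ) ≡ 1 × (∀ j → j < i → ∃ λ z → stage p t (j ∷ ρ) ≡ suc (suc z))
μ-found p t ρ (suc b) i e with μ-state p t ρ b in eq | stage p t (b ∷ ρ) in eq′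
μ-found p t ρ (suc b) .b refl | zero | suc zero = ≤-refl , eq′ , μ-searching p t ρ b eq
μ-found p t ρ (suc b) i refl | suc .(suc i) | _ with μ-found p t ρ b i eq
... | l , r = m≤n⇒m≤1+n l , r

μ-searching⁻ : (p : PR (suc n)) → ∀ t ρ b → (∀ j → j < b → ∃ λ z → stage p t (j ∷ ρ) ≡ suc (suc z)) →
  μ-state p t ρ b ≡ 0
μ-searching⁻ p t ρ zero    all = refl
μ-searching⁻ p t ρ (suc b) all
  rewrite μ-searching⁻ p t ρ b (λ j l → all j (m≤n⇒m≤1+n l)) | proj₂ (all b ≤-refl) = refl

μ-found⁻ : (p : PR (suc n)) → ∀ t ρ b i → i < b → stage p t (i ∷ ρ) ≡ 1 →
  (∀ j → j < i → ∃ λ z → stage p t (j ∷ ρ) ≡ suc (suc z)) → μ-state p t ρ b ≡ suc (suc i)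
μ-found⁻ p t ρ (suc b) i l e all with m≤n⇒m<n∨m≡n (≤-pred l)
... | inj₁ i<b rewrite μ-found⁻ p t ρ b i i<b e all = refl
... | inj₂ refl rewrite μ-searching⁻ p t ρ b all | e = refl

stage-mono : (p : PR n) → ∀ {t t′} ρ {y} → t ≤ t′ → stage p t ρ ≡ suc y → stage p t′ ρ ≡ suc y
stages-mono : (ps : Vec (PR n) m) → ∀ {t t′} ρ {b} → t ≤ t′ → all-defined (stages ps t ρ) ≡ suc b →
  stages ps t′ ρ ≡ stages ps t ρ

stage-mono zer         ρ       l e = e
stage-mono succ        (x ∷ _) l e = e
stage-mono (proj i)    ρ       l e = e
stage-mono (comp p ps) {t} ρ l e with gate-suc (all-defined (stages ps t ρ)) e
... | b , eq , e′ rewrite stages-mono ps ρ l eq | eq = stage-mono p _ l e′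
stage-mono (prim p q) {t} {t′} (k ∷ ρ) l e = go k e
  where
  go : ∀ k {y} → stage (prim p q) t (k ∷ ρ) ≡ suc y → stage (prim p q) t′ (k ∷ ρ) ≡ suc y
  go zero    e = stage-mono p ρ l e
  go (suc k) e with gate-suc (stage (prim p q) t (k ∷ ρ)) e
  ... | b , eq , e′ rewrite go k eq | eq = stage-mono q _ l e′
stage-mono (mu p) {t} {t′} ρ {y} l e =
  let i<t , z , all = μ-found p t ρ t y (lem _ e) in
  cong pred (μ-found⁻ p t′ ρ t′ y (≤-trans i<t l) (stage-mono p _ l z)
    (λ j j<y → let z , eq = all j j<y in z , stage-mono p _ l eq))
  where
  lem : ∀ a → pred a ≡ suc y → a ≡ suc (suc y)
  lem (suc a) refl = refl

stages-mono []       ρ l e = refl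
stages-mono (p ∷ ps) {t} ρ l e with gate-suc (stage p t ρ) e
... | b , eq , e′ = cong₂ _∷_ (trans (stage-mono p ρ l eq) (sym eq)) (stages-mono ps ρ l e′)

stage-sound : (p : PR n) → ∀ t ρ {y} → stage p t ρ ≡ suc y → p ⟦ ρ ⟧⇓ y
stages-sound : (ps : Vec (PR n) m) → ∀ t ρ {b} → all-defined (stages ps t ρ) ≡ suc b →
  ps ⟦ ρ ⟧⇓* map pred (stages ps t ρ)

stage-sound zer         t ρ        refl = zerE
stage-sound succ        t (x ∷ []) refl = succE
stage-sound (proj i)    t ρ        refl = projE
stage-sound (comp p ps) t ρ e with gate-suc (all-defined (stages ps t ρ)) e
... | b , eq , e′ = compE (stages-sound ps t ρ eq) (stage-sound p t _ e′)
stage-sound (prim p q) t (k ∷ ρ) e = go k e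
  where
  go : ∀ k {y} → stage (prim p q) t (k ∷ ρ) ≡ suc y → prim p q ⟦ k ∷ ρ ⟧⇓ y
  go zero    e = primZ (stage-sound p t ρ e)
  go (suc k) e with gate-suc (stage (prim p q) t (k ∷ ρ)) e
  ... | b , eq , e′ rewrite eq = primS (go k eq) (stage-sound q t _ e′)
stage-sound (mu p) t ρ {y} e =
  let _ , z , all = μ-found p t ρ t y (lem _ e) in muE (go z all 0 y (+-identityʳ y))
  where
  lem : ∀ a → pred a ≡ suc y → a ≡ suc (suc y)
  lem (suc a) refl = refl
  go : stage p t (y ∷ ρ) ≡ 1 → (∀ j → j < y → ∃ λ z → stage p t (j ∷ ρ) ≡ suc (suc z)) →
       ∀ i d → d + i ≡ y → MuFrom p ρ i y
  go z all i zero    refl = here (stage-sound p t _ z)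
  go z all i (suc d) eq   =
    let w , e = all i (subst (i <_) eq (s≤s (m≤n+m i d))) in
    there (stage-sound p t _ e) (go z all (suc i) d (trans (+-suc d i) eq))

stages-sound []       t ρ e = []
stages-sound (p ∷ ps) t ρ e with gate-suc (stage p t ρ) e
... | b , eq , e′ = stage-sound p t ρ (trans eq (cong suc (sym (cong pred eq)))) ∷ stages-sound ps t ρ e′

stage-complete : (p : PR n) → ∀ {ρ y} → p ⟦ ρ ⟧⇓ y → ∃ λ t → stage p t ρ ≡ suc y
stages-complete : (ps : Vec (PR n) m) → ∀ {ρ ys} → ps ⟦ ρ ⟧⇓* ys → ∃ λ t → stages ps t ρ ≡ map suc ys
μ-complete : (p : PR (suc n)) → ∀ {ρ i y} → MuFrom p ρ i y → ∃ λ t →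
  i ≤ y × stage p t (y ∷ ρ) ≡ 1 × (∀ j → i ≤ j → j < y → ∃ λ z → stage p t (j ∷ ρ) ≡ suc (suc z))

all-defined-suc : (ys : Vec ℕ m) → all-defined (map suc ys) ≡ 1
all-defined-suc []       = refl
all-defined-suc (y ∷ ys) = all-defined-suc ys

map-pred-suc : (ys : Vec ℕ m) → map pred (map suc ys) ≡ ys
map-pred-suc []       = refl
map-pred-suc (y ∷ ys) = cong (y ∷_) (map-pred-suc ys)

stages-lift : (ps : Vec (PR n) m) → ∀ {t t′ ρ ys} → t ≤ t′ → stages ps t ρ ≡ map suc ys →
  stages ps t′ ρ ≡ map suc ys
stages-lift ps {ρ = ρ} {ys} l e =
  trans (stages-mono ps ρ l (trans (cong all-defined e) (all-defined-suc ys))) e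

stage-complete zer      zerE  = 0 , refl
stage-complete succ     succE = 0 , refl
stage-complete (proj i) projE = 0 , refl
stage-complete (comp p ps) {ρ} (compE {ys = ys} ds d) with stages-complete ps ds | stage-complete p d
... | t , e | t′ , e′ = t ⊔ t′ , eq
  where
  eq : stage (comp p ps) (t ⊔ t′) ρ ≡ suc _
  eq rewrite stages-lift ps {ys = ys} (m≤m⊔n t t′) e | all-defined-suc ys | map-pred-suc ys =
    stage-mono p ys (m≤n⊔m t t′) e′
stage-complete (prim p q) (primZ d) = stage-complete p d
stage-complete (prim p q) (primS {xs = ρ} {k = k} {a = a} d d′)
  with stage-complete (prim p q) d | stage-complete q d′
... | t , e | t′ , e′ = t ⊔ t′ , eq
  where
  eq : stage (prim p q) (t ⊔ t′) (suc k ∷ ρ) ≡ suc _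
  eq rewrite stage-mono (prim p q) (k ∷ ρ) (m≤m⊔n t t′) e = stage-mono q _ (m≤n⊔m t t′) e′
stage-complete (mu p) {ρ} {y} (muE d) with μ-complete p d
... | t , _ , z , all = T , cong pred (μ-found⁻ p T ρ T y (m≤n⊔m t (suc y)) (stage-mono p _ (m≤m⊔n t _) z)
        (λ j l → let w , e = all j z≤n l in w , stage-mono p _ (m≤m⊔n t _) e))
  where
  T = t ⊔ suc y

stages-complete []       []       = 0 , refl
stages-complete (p ∷ ps) {ρ} (_∷_ {ys = ys} d ds) with stage-complete p d | stages-complete ps ds
... | t , e | t′ , e′ = t ⊔ t′ ,
  cong₂ _∷_ (stage-mono p ρ (m≤m⊔n t t′) e) (stages-lift ps {ys = ys} (m≤n⊔m t t′) e′)

μ-complete p (here d) with stage-complete p d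
... | t , e = t , ≤-refl , e , λ j i≤j j<i → ⊥-elim (≤⇒≯ i≤j j<i)
μ-complete p {ρ} {i} {y} (there {z = z} d ds) with stage-complete p d | μ-complete p ds
... | t , e | t′ , l , e₀ , all = t ⊔ t′ , <⇒≤ l , stage-mono p _ (m≤n⊔m t t′) e₀ , below
  where
  below : ∀ j → i ≤ j → j < y → ∃ λ z → stage p (t ⊔ t′) (j ∷ ρ) ≡ suc (suc z)
  below j i≤j j<y with m≤n⇒m<n∨m≡n i≤j
  ... | inj₁ i<j  = let w , e = all j i<j j<y in w , stage-mono p _ (m≤n⊔m t t′) e
  ... | inj₂ refl = z , stage-mono p _ (m≤m⊔n t t′) e

-- Each derivation shows up in `stage` at some bound, and at the larger bound both values are the
-- same term.
⇓-deterministic : (p : PR n) → ∀ {ρ y z} → p ⟦ ρ ⟧⇓ y → p ⟦ ρ ⟧⇓ z → y ≡ z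
⇓-deterministic p {ρ} d d′ with stage-complete p d | stage-complete p d′
... | t , e | t′ , e′ = suc-injective
  (trans (sym (stage-mono p ρ (m≤m⊔n t t′) e)) (stage-mono p ρ (m≤n⊔m t t′) e′))

μ-step-comp : Comp f → Comp g → Comp h → Comp (λ ρ → μ-step (f ρ) (g ρ) (h ρ))
μ-step-comp {f = f} {g = g} {h = h} cf cg ch =
  comp-ext (λ ρ → lem (f ρ) (g ρ) (h ρ))
    (ifd-comp (rec-≡ cf (const-comp 0)) (λ ρ → f ρ ≟ 0)
      (ifd-comp (rec-≡ cg (const-comp 0)) (λ ρ → g ρ ≟ 0) (const-comp 1)
        (ifd-comp (rec-≡ cg (const-comp 1)) (λ ρ → g ρ ≟ 1) (suc-comp (suc-comp ch)) (const-comp 0)))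
      cf)
  where
  lem : ∀ a v n → ifd (a ≟ 0) (ifd (v ≟ 0) 1 (ifd (v ≟ 1) (suc (suc n)) 0)) a ≡ μ-step a v n
  lem (suc a) v             n = refl
  lem zero    zero          n = refl
  lem zero    (suc zero)    n = refl
  lem zero    (suc (suc v)) n = refl

stage-comp₀ : (p : PR n) → Comp {suc n} (λ ρ → stage p (head ρ) (tail ρ))
stages-comp : (ps : Vec (PR n) m) →
  Comps {suc n} (λ ρ → map pred (stages ps (head ρ) (tail ρ))) ×
  Comp {suc n} (λ ρ → all-defined (stages ps (head ρ) (tail ρ)))

stage-comp₀ zer         = const-comp 1
stage-comp₀ succ        = comp-ext (λ { (t ∷ x ∷ []) → refl }) (suc-comp (suc-comp (var (suc zero))))
stage-comp₀ (proj i)    = suc-comp (wk (var i))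
stage-comp₀ (comp p ps) =
  gate-comp (proj₂ (stages-comp ps)) (stage-comp₀ p ∘ᶜ (head-comp ,, proj₁ (stages-comp ps)))
stage-comp₀ (prim p q)  = comp-ext (λ { (t ∷ k ∷ ρ) → refl })
  (comp-natrec (stage-comp₀ p ∘ᶜ (var zero ,, tail²-comps))
    (gate-comp (var (suc zero)) (stage-comp₀ q ∘ᶜ
      (var (suc (suc zero)) ,, var zero ,, pred-comp (var (suc zero)) ,,
        tail⁴)))
    (var (suc zero)))
  where
  tail⁴ : ∀ {n} → Comps {suc (suc (suc (suc n)))} (λ ρ → tail (tail (tail (tail ρ))))
  tail⁴ = comps-ext (λ { (a ∷ b ∷ c ∷ d ∷ ρ) → tabulate∘lookup ρ })
            (rename (λ i → suc (suc (suc (suc i)))))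
stage-comp₀ (mu p)      = comp-ext (λ { (t ∷ ρ) → refl }) (pred-comp
  (comp-natrec (const-comp 0)
    (μ-step-comp (var (suc zero))
      (stage-comp₀ p ∘ᶜ (var (suc (suc zero)) ,, var zero ,, tail³)) (var zero))
    head-comp))
  where
  tail³ : ∀ {n} → Comps {suc (suc (suc n))} (λ ρ → tail (tail (tail ρ)))
  tail³ = comps-ext (λ { (a ∷ b ∷ c ∷ ρ) → tabulate∘lookup ρ })
            (rename (λ i → suc (suc (suc i))))

stages-comp []       = nil , const-comp 1
stages-comp (p ∷ ps) =
  (pred-comp (stage-comp₀ p) ,, proj₁ (stages-comp ps)) , gate-comp (stage-comp₀ p) (proj₂ (stages-comp ps))

stage-comp : (p : PR m) → {F : Vec ℕ n → Vec ℕ m} → Comp f → Comps F → Comp (λ ρ → stage p (f ρ) (F ρ))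
stage-comp p ct cF = stage-comp₀ p ∘ᶜ (ct ,, cF)

-- Pairing of natural numbers

opaque
  -- With `s = x + y` the code lies between `s * s` and `s * s + s`, so different sums occupy
  -- disjoint intervals.
  pair : ℕ → ℕ → ℕ
  pair x y = (x + y) * (x + y) + x

  pair-comp : Comp f → Comp g → Comp (λ ρ → pair (f ρ) (g ρ))
  pair-comp cf cg = +-comp (*-comp (+-comp cf cg) (+-comp cf cg)) cf

  pair-mono : ∀ {x y x′ y′} → x + y < x′ + y′ → pair x y < pair x′ y′
  pair-mono {x} {y} {x′} {y′} l = begin-strict
    (x + y) * (x + y) + x          ≤⟨ +-monoʳ-≤ ((x + y) * (x + y)) (m≤m+n x y) ⟩
    (x + y) * (x + y) + (x + y)    ≡⟨ +-comm ((x + y) * (x + y)) (x + y) ⟩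
    suc (x + y) * (x + y)          <⟨ *-monoʳ-< (suc (x + y)) (n<1+n (x + y)) ⟩
    suc (x + y) * suc (x + y)      ≤⟨ *-mono-≤ l l ⟩
    (x′ + y′) * (x′ + y′)          ≤⟨ m≤m+n _ x′ ⟩
    pair x′ y′                     ∎
    where open ≤-Reasoning

  pair-injective : ∀ {x y x′ y′} → pair x y ≡ pair x′ y′ → x ≡ x′ × y ≡ y′
  pair-injective {x} {y} {x′} {y′} e with <-cmp (x + y) (x′ + y′)
  ... | tri< l _ _ = ⊥-elim (<-irrefl e (pair-mono {x} {y} {x′} {y′} l))
  ... | tri> _ _ l = ⊥-elim (<-irrefl (sym e) (pair-mono {x′} {y′} {x} {y} l))
  ... | tri≈ _ s _ = x≡x′ , +-cancelˡ-≡ x y y′ (trans s (cong (_+ y′) (sym x≡x′)))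
    where
    x≡x′ : x ≡ x′
    x≡x′ = +-cancelˡ-≡ ((x + y) * (x + y)) x x′ (trans e (cong (λ s → s * s + x′) (sym s)))

  n≤n*n : ∀ n → n ≤ n * n
  n≤n*n zero    = z≤n
  n≤n*n (suc n) = m≤m+n (suc n) _

  x≤pair : ∀ x y → x ≤ pair x y
  x≤pair x y = m≤n+m x _

  y≤pair : ∀ x y → y ≤ pair x y
  y≤pair x y = ≤-trans (m≤n+m y x) (≤-trans (n≤n*n (x + y)) (m≤m+n _ x))

IsFst : ℕ → ℕ → Set
IsFst z x = ∃< (suc z) (λ y → pair x y ≡ z)

IsSnd : ℕ → ℕ → Set
IsSnd z y = ∃< (suc z) (λ x → pair x y ≡ z)

isFst-rec : Rec {2} (λ ρ → IsFst (lookup ρ (suc zero)) (lookup ρ zero))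
isFst-rec = rec-∃< (suc-comp (var (suc zero)))
  (rec-≡ (pair-comp (var (suc zero)) (var zero)) (var (suc (suc zero))))

isSnd-rec : Rec {2} (λ ρ → IsSnd (lookup ρ (suc zero)) (lookup ρ zero))
isSnd-rec = rec-∃< (suc-comp (var (suc zero)))
  (rec-≡ (pair-comp (var zero) (var (suc zero))) (var (suc (suc zero))))

isFst? : ∀ z x → Dec (IsFst z x)
isFst? z x = rec-dec isFst-rec (x ∷ z ∷ [])

isSnd? : ∀ z x → Dec (IsSnd z x)
isSnd? z x = rec-dec isSnd-rec (x ∷ z ∷ [])

opaque
  -- Both components are at most the code, which bounds the search. Off the range of `pair` the
  -- result is the default `suc z`.
  fst snd : ℕ → ℕ
  fst z = search (isFst? z) (suc z)
  snd z = search (isSnd? z) (suc z)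

  fst-pair : ∀ x y → fst (pair x y) ≡ x
  fst-pair x y =
    let _ , _ , _ , e = search-found (isFst? (pair x y)) (x , s≤s (x≤pair x y) , y , s≤s (y≤pair x y) , refl)
    in proj₁ (pair-injective e)

  snd-pair : ∀ x y → snd (pair x y) ≡ y
  snd-pair x y =
    let _ , _ , _ , e = search-found (isSnd? (pair x y)) (y , s≤s (y≤pair x y) , x , s≤s (x≤pair x y) , refl)
    in proj₂ (pair-injective e)

  fst-comp : Comp f → Comp (λ ρ → fst (f ρ))
  fst-comp cf = search-comp isFst-rec (λ ρ x → isFst? (lookup ρ zero) x) (suc-comp (var zero)) ∘ᶜ (cf ,, nil)

  snd-comp : Comp f → Comp (λ ρ → snd (f ρ))
  snd-comp cf = search-comp isSnd-rec (λ ρ x → isSnd? (lookup ρ zero) x) (suc-comp (var zero)) ∘ᶜ (cf ,, nil)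

-- The game

parity : ℕ → ℕ
parity zero          = 0
parity (suc zero)    = 1
parity (suc (suc n)) = parity n

Even : ℕ → Set
Even n = parity n ≡ 0

double : ℕ → ℕ
double zero    = 0
double (suc n) = suc (suc (double n))

even? : ∀ n → Dec (Even n)
even? n = parity n ≟ 0

double-even : ∀ n → Even (double n)
double-even zero    = refl
double-even (suc n) = double-even n

odd-not-even : ∀ n → ¬ Even (suc (double n))
odd-not-even (suc n) e = odd-not-even n e

halve : ∀ n → (∃ λ e → n ≡ double e) ⊎ (∃ λ e → n ≡ suc (double e))
halve zero          = inj₁ (0 , refl)
halve (suc zero)    = inj₂ (0 , refl)
halve (suc (suc n)) with halve n
... | inj₁ (e , refl) = inj₁ (suc e , refl)
... | inj₂ (e , refl) = inj₂ (suc e , refl)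

double-injective : ∀ {m n} → double m ≡ double n → m ≡ n
double-injective {zero}  {zero}  e = refl
double-injective {suc m} {suc n} e = cong suc (double-injective (suc-injective (suc-injective e)))

double-mono : ∀ {m n} → m ≤ n → double m ≤ double n
double-mono z≤n     = z≤n
double-mono (s≤s l) = s≤s (s≤s (double-mono l))

double-cancel-< : ∀ {m n} → double m < double n → m < n
double-cancel-< l = ≰⇒> λ n≤m → <⇒≱ l (double-mono n≤m)

double≢odd : ∀ {m n} → double m ≢ suc (double n)
double≢odd {m} {n} e = odd-not-even n (trans (cong parity (sym e)) (double-even m))

first : {P : ℕ → Set} → (∀ x → Dec (P x)) → ∀ t d → P (d + t) →
  ∃ λ u → t ≤ u × P u × (∀ s → t ≤ s → s < u → ¬ P s)
first P? t zero    p = t , ≤-refl , p , λ s t≤s s<t → ⊥-elim (<⇒≱ s<t t≤s)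
first {P} P? t (suc d) p with P? t
... | yes q = t , ≤-refl , q , λ s t≤s s<t → ⊥-elim (<⇒≱ s<t t≤s)
... | no ¬q with first P? (suc t) d (subst P (sym (+-suc d t)) p)
... | u , l , q , least = u , <⇒≤ l , q , λ s t≤s s<u → step s s<u (m≤n⇒m<n∨m≡n t≤s)
  where
  step : ∀ s → s < u → suc t ≤ s ⊎ t ≡ s → ¬ P s
  step s s<u (inj₁ l′)   = least s l′ s<u
  step s s<u (inj₂ refl) = ¬q

-- v c x t is the stage-t value of slot c at x (0 = undefined, suc y = value y), and m x is the
-- largest action at a stage in [x, t), where action 0 is waiting and double e + 1, double e + 2
-- are the odd and even actions of level e; the point x becomes available at stage x.
-- InP e x says that x lies in the base of level e, InU e x (for x < t) that it lies there or has
-- been available since the current subtree of level e was started.  The active set is InP 0.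
-- Right e holds while the right subtree of level e is being played.
module Snapshot (v : ℕ → ℕ → ℕ → ℕ) {k : ℕ} (F : ℕ → Fin k → ℕ) (m : ℕ → ℕ) (t : ℕ) where

  InP InU : ℕ → ℕ → Set
  InP e x = Even (m x) × double e < m x
  InU e x = m x ≤ double e ⊎ Even (m x)

  Exact : ℕ → Set
  Exact c = ∀ x → x < t → (InP 0 x → v c x t ≡ 1) × (¬ InP 0 x → v c x t ≡ 0)

  -- `Cond e c` is counting at `e`. The code 1 in `Live` is the value 0, so showing any other value
  -- disqualifies a candidate. `Good` makes `e` a safe level for an action on slot `c`.
  Live Out Cond Good : ℕ → ℕ → Set
  Live e c = ∀ x → x < t → v c x t ≡ 0 ⊎ (v c x t ≡ 1 × InU e x)
  Out  e c = ∃< t λ x → v c x t ≢ 0 × ¬ InP e x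
  Cond e c = Live e c × Out e c
  Good e c = ∀ i → Cond (suc e) (F c i) → Cond e (F c i)

  Right : ℕ → Set
  Right e = ∃< t λ x → m x ≡ suc (double e)

  inP? : ∀ e x → Dec (InP e x)
  inP? e x = even? (m x) ×-dec (double e <? m x)

-- The combinatorial core, free of programs: `a t` is the action at stage `t`, `tok t` the active
-- token, `B l` the bound on the slots of token `l`, and `F c (ix c)` the minimal index of `c`. The
-- hypotheses of `min-unique` are doubly negated because limits of the play are known only in that
-- form.
module Game
  (v : ℕ → ℕ → ℕ → ℕ) (v-mono : ∀ c x {t t′ y} → t ≤ t′ → v c x t ≡ suc y → v c x t′ ≡ suc y)
  {k : ℕ} (F : ℕ → Fin k → ℕ) (ix : ℕ → Fin k)
  (min-to   : ∀ c {x t y} → v (F c (ix c)) x t ≡ suc y → ∃ λ t′ → v c x t′ ≡ suc y)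
  (min-from : ∀ c {x t y} → v c x t ≡ suc y → ∃ λ t′ → v (F c (ix c)) x t′ ≡ suc y)
  (min-unique : ∀ c c′ →
    (∀ x t y → v c x t ≡ suc y → ¬ ¬ ∃ λ t′ → v c′ x t′ ≡ suc y) →
    (∀ x t y → v c′ x t ≡ suc y → ¬ ¬ ∃ λ t′ → v c x t′ ≡ suc y) →
    F c (ix c) ≡ F c′ (ix c′))
  (D : ℕ) (a : ℕ → ℕ) (M : ℕ → ℕ → ℕ)
  (M-zero : ∀ {x t} → t ≤ x → M x t ≡ 0)
  (M-suc  : ∀ {x t} → x ≤ t → M x (suc t) ≡ a t ⊔ M x t)
  (tok : ℕ → ℕ) (Λ : ℕ) (tok<Λ : ∀ t → tok t < Λ)
  (B : ℕ → ℕ)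
  where

  module At (t : ℕ) = Snapshot v F (λ x → M x t) t

  Used : ℕ → ℕ → ℕ → Set
  Used t e c = c ≤ B (tok t) × At.Exact t c × At.Good t e c

  module Play
    (tok-right : ∀ {t t′} → tok t ≡ tok t′ → ∀ e → e < D → At.Right t e → At.Right t′ e)
    (right-tok : ∀ {t t′} → (∀ e → e < D → At.Right t e → At.Right t′ e) →
                            (∀ e → e < D → At.Right t′ e → At.Right t e) → tok t ≡ tok t′)
    (a-spec : ∀ t → (a t ≡ 0 × (∀ c → c ≤ B (tok t) → ¬ At.Exact t c)) ⊎
      (∃₂ λ e c → e < D × Used t e c ×
        ((At.Right t e × a t ≡ double (suc e)) ⊎ (¬ At.Right t e × a t ≡ suc (double e)))))
    (token-slot : ∀ l → ∃ λ j → j ≤ B l ×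
      (∀ x t → tok t ≡ l → At.InP t 0 x → ∃ λ s → v j x s ≡ 1) ×
      (∀ x s → v j x s ≢ 0 → v j x s ≡ 1 × ∃ λ t → tok t ≡ l × At.InP t 0 x))
    where

    open At

    M-split : ∀ {x t t′} → x ≤ t → t ≤ t′ → M x t′ ≡ M t t′ ⊔ M x t
    M-split {x} {t} {zero}   x≤t z≤n rewrite n≤0⇒n≡0 x≤t = cong (_⊔ M 0 0) (sym (M-zero z≤n))
    M-split {x} {t} {suc t′} x≤t t≤t′ with m≤n⇒m<n∨m≡n t≤t′
    ... | inj₂ refl = cong (_⊔ M x (suc t′)) (sym (M-zero ≤-refl))
    ... | inj₁ l    = begin
      M x (suc t′)                  ≡⟨ M-suc (≤-trans x≤t (≤-pred l)) ⟩
      a t′ ⊔ M x t′                 ≡⟨ cong (a t′ ⊔_) (M-split x≤t (≤-pred l)) ⟩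
      a t′ ⊔ (M t t′ ⊔ M x t)       ≡⟨ ⊔-assoc (a t′) (M t t′) (M x t) ⟨
      (a t′ ⊔ M t t′) ⊔ M x t       ≡⟨ cong (_⊔ M x t) (M-suc (≤-pred l)) ⟨
      M t (suc t′) ⊔ M x t          ∎
      where open ≡-Reasoning

    M-lub : ∀ x t {b} → (∀ s → x ≤ s → s < t → a s ≤ b) → M x t ≤ b
    M-lub x zero    ub = ≤-trans (≤-reflexive (M-zero z≤n)) z≤n
    M-lub x (suc t) ub with x ≤? t
    ... | yes l = ≤-trans (≤-reflexive (M-suc l))
                    (⊔-lub (ub t l ≤-refl) (M-lub x t λ s x≤s s<t → ub s x≤s (m≤n⇒m≤1+n s<t)))
    ... | no l  = ≤-trans (≤-reflexive (M-zero (≰⇒> l))) z≤n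

    M-ub : ∀ {x s t} → x ≤ s → s < t → a s ≤ M x t
    M-ub {x} {s} {t} x≤s s<t = begin
      a s                     ≤⟨ m≤m⊔n (a s) (M x s) ⟩
      a s ⊔ M x s             ≡⟨ M-suc x≤s ⟨
      M x (suc s)             ≤⟨ m≤n⊔m (M (suc s) t) (M x (suc s)) ⟩
      M (suc s) t ⊔ M x (suc s) ≡⟨ M-split (m≤n⇒m≤1+n x≤s) s<t ⟨
      M x t                   ∎
      where open ≤-Reasoning

    M-attained : ∀ x t {b} → M x t ≡ suc b → ∃ λ s → x ≤ s × s < t × a s ≡ suc b
    M-attained x zero    e with () ← trans (sym e) (M-zero z≤n)
    M-attained x (suc t) e with x ≤? t
    ... | no l with () ← trans (sym e) (M-zero (≰⇒> l))
    ... | yes l with ⊔-sel (a t) (M x t)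
    ... | inj₁ eq = t , l , ≤-refl , trans (sym eq) (trans (sym (M-suc l)) e)
    ... | inj₂ eq with M-attained x t (trans (sym eq) (trans (sym (M-suc l)) e))
    ... | s , x≤s , s<t , eq′ = s , x≤s , m≤n⇒m≤1+n s<t , eq′

    M-pos⇒< : ∀ {x t} → 0 < M x t → x < t
    M-pos⇒< {x} {t} l = ≰⇒> λ t≤x → <-irrefl (sym (M-zero t≤x)) l

    a≤ : ∀ t → a t ≤ double D
    a≤ t with a-spec t
    ... | inj₁ (e , _) = ≤-trans (≤-reflexive e) z≤n
    ... | inj₂ (e , _ , e<D , _ , inj₁ (_ , eq)) = ≤-trans (≤-reflexive eq) (double-mono e<D)
    ... | inj₂ (e , _ , e<D , _ , inj₂ (_ , eq)) = ≤-trans (≤-reflexive eq) (<⇒≤ (double-mono e<D))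

    odd-action : ∀ {t e} → a t ≡ suc (double e) → ¬ Right t e × ∃ (Used t e)
    odd-action {t} {e} eq with a-spec t
    ... | inj₁ (z , _) with () ← trans (sym eq) z
    ... | inj₂ (_ , _ , _ , _ , inj₁ (_ , eq′)) = ⊥-elim (double≢odd (trans (sym eq′) eq))
    ... | inj₂ (_ , c , _ , u , inj₂ (¬r , eq′))
      with refl ← double-injective (suc-injective (trans (sym eq) eq′)) = ¬r , c , u

    even-action : ∀ {t e} → a t ≡ double (suc e) → Right t e × ∃ (Used t e)
    even-action {t} {e} eq with a-spec t
    ... | inj₁ (z , _) with () ← trans (sym eq) z
    ... | inj₂ (_ , _ , _ , _ , inj₂ (_ , eq′)) = ⊥-elim (double≢odd (trans (sym eq) eq′))
    ... | inj₂ (_ , c , _ , u , inj₁ (r , eq′))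
      with refl ← double-injective (trans (sym eq) eq′) = r , c , u

    -- Suppose the largest action in `[t, t′)` exceeds the maximum of `x` and is odd, of level `e`.
    -- Then `e` is on its right side at `t′`, hence already at `t` since the token is the same, and
    -- stays there until that action, which therefore cannot be odd. In all other cases the maximum
    -- of `x` remains even.
    token-grows : ∀ {t t′} → t ≤ t′ → tok t ≡ tok t′ → ∀ {x} → InP t 0 x → InP t′ 0 x
    token-grows {t} {t′} t≤t′ eq {x} (ev , pos) with M t t′ ≤? M x t
    ... | yes l = subst Even (sym same) ev , subst (0 <_) (sym same) pos
      where
      same : M x t′ ≡ M x t
      same = trans (M-split (<⇒≤ (M-pos⇒< pos)) t≤t′) (m≤n⇒m⊔n≡n l)
    ... | no l with halve (M t t′)
    ... | inj₁ (e , eq′) = subst Even (sym (trans same eq′)) (double-even e) ,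
                           subst (0 <_) (sym same) (<-trans pos (≰⇒> l))
      where
      same : M x t′ ≡ M t t′
      same = trans (M-split (<⇒≤ (M-pos⇒< pos)) t≤t′) (m≥n⇒m⊔n≡m (<⇒≤ (≰⇒> l)))
    ... | inj₂ (e , eq′) with M-attained t t′ eq′
    ... | s , t≤s , s<t′ , as with tok-right (sym eq) e e<D (t , ≤-<-trans t≤s s<t′ , eq′)
      where
      e<D : e < D
      e<D = double-cancel-< (subst (_≤ double D) as (a≤ s))
    ... | y , y<t , My = ⊥-elim (proj₁ (odd-action as) (y , <-≤-trans y<t t≤s ,
        trans (M-split (<⇒≤ y<t) t≤s) (trans (m≤n⇒m⊔n≡n (≤-trans Mts≤ (≤-reflexive (sym My)))) My)))
      where
      Mts≤ : M t s ≤ suc (double e)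
      Mts≤ = M-lub t s λ r t≤r r<s → ≤-trans (M-ub t≤r (<-trans r<s s<t′)) (≤-reflexive eq′)

    Eventually≤ : ℕ → Set
    Eventually≤ b = ∃ λ t₀ → ∀ t → t₀ ≤ t → a t ≤ b

    all-seen : ∀ j (P : ℕ → Set) → (∀ x → Dec (P x)) → (∀ x → P x → ∃ λ s → v j x s ≡ 1) → ∀ b →
      ∃ λ T → ∀ x → x < b → P x → v j x T ≡ 1
    all-seen j P P? seen zero    = 0 , λ x ()
    all-seen j P P? seen (suc b) with all-seen j P P? seen b | P? b
    ... | T , all | no ¬p = T , λ x x<b p → step x p (m≤n⇒m<n∨m≡n (≤-pred x<b))
      where
      step : ∀ x → P x → x < b ⊎ x ≡ b → v j x T ≡ 1
      step x p (inj₁ l)    = all x l p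
      step x p (inj₂ refl) = ⊥-elim (¬p p)
    ... | T , all | yes q = T ⊔ proj₁ (seen b q) , λ x x<b p → step x p (m≤n⇒m<n∨m≡n (≤-pred x<b))
      where
      step : ∀ x → P x → x < b ⊎ x ≡ b → v j x (T ⊔ proj₁ (seen b q)) ≡ 1
      step x p (inj₁ l)    = v-mono j x (m≤m⊔n T _) (all x l p)
      step x p (inj₂ refl) = v-mono j x (m≤n⊔m T _) (proj₂ (seen b q))

    -- After the last action all maxima are frozen. The slot `j` of the final token eventually shows
    -- the finitely many points of the active set and never any other, so it is exact and waiting
    -- violates `a-spec`.
    not-stuck : ¬ Eventually≤ 0
    not-stuck (t₀ , idle) with token-slot (tok t₀)
    ... | j , j≤B , covers , within with all-seen j (InP t₀ 0) (inP? t₀ 0) (λ x → covers x t₀ refl) t₀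
    ... | T₁ , all = refute (a-spec T)
      where
      T = t₀ ⊔ T₁
      t₀≤T : t₀ ≤ T
      t₀≤T = m≤m⊔n t₀ T₁
      frozen : ∀ {t} x → t₀ ≤ t → M x t ≡ M x t₀
      frozen {t} x l with x ≤? t₀
      ... | yes x≤t₀ = trans (M-split x≤t₀ l)
        (cong (_⊔ M x t₀) (n≤0⇒n≡0 (M-lub t₀ t λ s t₀≤s _ → idle s t₀≤s)))
      ... | no x≰t₀ = trans (n≤0⇒n≡0 (M-lub x t λ s x≤s _ → idle s (≤-trans (<⇒≤ (≰⇒> x≰t₀)) x≤s)))
                        (sym (M-zero (<⇒≤ (≰⇒> x≰t₀))))
      same-tok : tok T ≡ tok t₀
      same-tok = right-tok
        (λ e _ (x , _ , eq) → let eq′ = trans (sym (frozen x t₀≤T)) eq in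
          x , M-pos⇒< (subst (0 <_) (sym eq′) z<s) , eq′)
        (λ e _ (x , x<t₀ , eq) → x , <-≤-trans x<t₀ t₀≤T , trans (frozen x t₀≤T) eq)
      inP-frozen : ∀ {t} x → t₀ ≤ t → InP t 0 x → InP t₀ 0 x
      inP-frozen x l (ev , pos) = subst Even (frozen x l) ev , subst (0 <_) (frozen x l) pos
      inP-thaw : ∀ {t} x → t₀ ≤ t → InP t₀ 0 x → InP t 0 x
      inP-thaw x l (ev , pos) = subst Even (sym (frozen x l)) ev , subst (0 <_) (sym (frozen x l)) pos
      exact : Exact T j
      exact x _ = pos , neg
        where
        pos : InP T 0 x → v j x T ≡ 1
        pos p = v-mono j x (m≤n⊔m t₀ T₁)
          (all x (M-pos⇒< (proj₂ (inP-frozen x t₀≤T p))) (inP-frozen x t₀≤T p))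
        neg : ¬ InP T 0 x → v j x T ≡ 0
        neg ¬p = decidable-stable (v j x T ≟ 0) λ nz → member (proj₂ (within x T nz))
          where
          member : ¬ ∃ λ t → tok t ≡ tok t₀ × InP t 0 x
          -- The token may have been active earlier, with a set that `token-grows` places inside the
          -- current one; later sets are frozen.
          member (t , eq , p) with ≤-total t T
          ... | inj₁ t≤T = ¬p (token-grows t≤T (trans eq (sym same-tok)) p)
          ... | inj₂ T≤t = ¬p (inP-thaw x t₀≤T (inP-frozen x (≤-trans t₀≤T T≤t) p))
      refute : _ → ⊥
      refute (inj₁ (_ , none)) = none j (subst (λ l → j ≤ B l) (sym same-tok) j≤B) exact
      refute (inj₂ (e , _ , _ , _ , inj₁ (_ , eq))) with () ← trans (sym eq) (n≤0⇒n≡0 (idle T t₀≤T))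
      refute (inj₂ (e , _ , _ , _ , inj₂ (_ , eq))) with () ← trans (sym eq) (n≤0⇒n≡0 (idle T t₀≤T))

    B-bound : ∀ n → ∃ λ G → ∀ l → l < n → B l ≤ G
    B-bound zero    = 0 , λ l ()
    B-bound (suc n) with B-bound n
    ... | G , ub = G ⊔ B n , λ l l<n → step l (m≤n⇒m<n∨m≡n (≤-pred l<n))
      where
      step : ∀ l → l < n ⊎ l ≡ n → B l ≤ G ⊔ B n
      step l (inj₁ l<n)  = ≤-trans (ub l l<n) (m≤m⊔n G (B n))
      step l (inj₂ refl) = m≤n⊔m G (B n)

    -- A level that bounds all late actions acts only finitely often.
    module Level (e : ℕ) (t₀ : ℕ) (late : ∀ t → t₀ ≤ t → a t ≤ double (suc e))
      (inf : ∀ T → ¬ ¬ ∃ λ t → T ≤ t × double e < a t) where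

      action : ∀ {t} → t₀ ≤ t → double e < a t → a t ≡ suc (double e) ⊎ a t ≡ double (suc e)
      action t₀≤t l with m≤n⇒m<n∨m≡n l
      ... | inj₂ eq = inj₁ (sym eq)
      ... | inj₁ l′ = inj₂ (≤-antisym (late _ t₀≤t) l′)

      used : ∀ {t} → t₀ ≤ t → double e < a t → ∃ (Used t e)
      used t₀≤t l with action t₀≤t l
      ... | inj₁ eq = proj₂ (odd-action eq)
      ... | inj₂ eq = proj₂ (even-action eq)

      -- An even action requires the right side, so between two even actions of the level there is
      -- an odd one.
      inf-odd : ∀ T → t₀ ≤ T → ¬ ¬ ∃ λ t → T ≤ t × a t ≡ suc (double e)
      inf-odd T t₀≤T none = inf T λ (t , T≤t , l) → go t T≤t (action (≤-trans t₀≤T T≤t) l)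
        where
        go : ∀ t → T ≤ t → ¬ (a t ≡ suc (double e) ⊎ a t ≡ double (suc e))
        go t T≤t (inj₁ eq) = none (t , T≤t , eq)
        go t T≤t (inj₂ eq) = inf (suc t) λ (u , t<u , l) →
          go′ u t<u (action (≤-trans t₀≤T (≤-trans T≤t (<⇒≤ t<u))) l)
          where
          go′ : ∀ u → t < u → ¬ (a u ≡ suc (double e) ⊎ a u ≡ double (suc e))
          go′ u t<u (inj₁ eq′) = none (u , ≤-trans T≤t (<⇒≤ t<u) , eq′)
          go′ u t<u (inj₂ eq′) with proj₁ (even-action eq′)
          ... | x , x<u , Mx with x ≤? t
          ... | yes x≤t = <-irrefl refl (≤-trans (≤-reflexive (sym eq))
                            (≤-trans (M-ub x≤t t<u) (≤-reflexive Mx)))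
          ... | no x≰t with M-attained x u Mx
          ... | s , x≤s , _ , as = none (s , ≤-trans T≤t (≤-trans (<⇒≤ (≰⇒> x≰t)) x≤s) , as)

      Round : ℕ → ℕ → Set
      Round t₁ t₂ = t₁ < t₂ × a t₁ ≡ suc (double e) × a t₂ ≡ double (suc e) ×
                    (∀ s → t₁ < s → s < t₂ → a s ≤ double e)

      -- The first action of the level after an odd one is even, since the odd action leaves the
      -- level on its right side until then.
      inf-round : ∀ T → t₀ ≤ T → ¬ ¬ ∃₂ λ t₁ t₂ → T ≤ t₁ × Round t₁ t₂
      inf-round T t₀≤T none = inf-odd T t₀≤T λ (t₁ , T≤t₁ , odd) → inf (suc t₁) λ (u , t₁<u , l) →
        go t₁ T≤t₁ odd (first (λ x → double e <? a x) (suc t₁) (u ∸ suc t₁)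
          (subst (λ w → double e < a w) (sym (m∸n+n≡m t₁<u)) l))
        where
        go : ∀ t₁ → T ≤ t₁ → a t₁ ≡ suc (double e) →
             ¬ ∃ λ t₂ → t₁ < t₂ × double e < a t₂ × (∀ s → t₁ < s → s < t₂ → ¬ double e < a s)
        go t₁ T≤t₁ odd (t₂ , t₁<t₂ , l , least)
          with action (≤-trans t₀≤T (≤-trans T≤t₁ (<⇒≤ t₁<t₂))) l
        ... | inj₂ eq = none (t₁ , t₂ , T≤t₁ , t₁<t₂ , odd , eq , λ s l₁ l₂ → ≮⇒≥ (least s l₁ l₂))
        ... | inj₁ eq = proj₁ (odd-action eq) (t₁ , t₁<t₂ , ≤-antisym
              (M-lub t₁ t₂ λ s t₁≤s s<t₂ → below s s<t₂ (m≤n⇒m<n∨m≡n t₁≤s))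
              (≤-trans (≤-reflexive (sym odd)) (M-ub ≤-refl t₁<t₂)))
          where
          below : ∀ s → s < t₂ → t₁ < s ⊎ t₁ ≡ s → a s ≤ suc (double e)
          below s s<t₂ (inj₁ t₁<s) = m≤n⇒m≤1+n (≮⇒≥ (least s t₁<s s<t₂))
          below s s<t₂ (inj₂ refl) = ≤-reflexive odd

      M-small : ∀ {x t} → t₀ ≤ t → M x t₀ ≤ double (suc e) → M x t ≤ double (suc e)
      M-small {x} {t} l sm with x ≤? t₀
      ... | yes x≤t₀ = ≤-trans (≤-reflexive (M-split x≤t₀ l))
                         (⊔-lub (M-lub t₀ t λ s t₀≤s _ → late s t₀≤s) sm)
      ... | no x≰t₀  = M-lub x t λ s x≤s _ → late s (≤-trans (<⇒≤ (≰⇒> x≰t₀)) x≤s)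

      M-large : ∀ {x t} → t₀ ≤ t → ¬ M x t₀ ≤ double (suc e) → M x t ≡ M x t₀
      M-large {x} {t} l ¬sm = trans (M-split (<⇒≤ x<t₀) l)
          (m≤n⇒m⊔n≡n (≤-trans (M-lub t₀ t λ s t₀≤s _ → late s t₀≤s) (<⇒≤ (≰⇒> ¬sm))))
        where
        x<t₀ : x < t₀
        x<t₀ = M-pos⇒< (≤-<-trans z≤n (≰⇒> ¬sm))

      -- The limit `E` of the active sets. A point whose maximum at `t₀` exceeds `double (suc e)`
      -- keeps that maximum for good; every other point, in particular each `x ≥ t₀`, enters with an
      -- even action of the level once it is available.
      InE : ℕ → Set
      InE x = M x t₀ ≤ double (suc e) ⊎ Even (M x t₀)

      inE? : ∀ x → Dec (InE x)
      inE? x = (M x t₀ ≤? double (suc e)) ⊎-dec even? (M x t₀)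

      inE⇒inU : ∀ {x t} → t₀ ≤ t → InE x → InU t (suc e) x
      inE⇒inU {x} l (inj₁ sm) = inj₁ (M-small l sm)
      inE⇒inU {x} l (inj₂ ev) with M x t₀ ≤? double (suc e)
      ... | yes sm = inj₁ (M-small l sm)
      ... | no ¬sm = inj₂ (subst Even (sym (M-large l ¬sm)) ev)

      inE⇒inP : ∀ {x s t} → t₀ ≤ s → a s ≡ double (suc e) → x ≤ s → s < t → InE x → InP t 0 x
      inE⇒inP {x} {s} {t} t₀≤s as x≤s s<t inE =
          even inE , <-≤-trans z<s (≤-trans (≤-reflexive (sym as)) (M-ub x≤s s<t))
        where
        t₀≤t = ≤-trans t₀≤s (<⇒≤ s<t)
        even : InE x → Even (M x t)
        even h with M x t₀ ≤? double (suc e) | h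
        ... | yes sm | _ = subst Even (≤-antisym (≤-trans (≤-reflexive (sym as)) (M-ub x≤s s<t))
                             (M-small t₀≤t sm)) (double-even (suc e))
        ... | no ¬sm | inj₁ sm = ⊥-elim (¬sm sm)
        ... | no ¬sm | inj₂ ev = subst Even (sym (M-large t₀≤t ¬sm)) ev

      inP⇒inE : ∀ {x t} → t₀ ≤ t → InP t 0 x → InE x
      inP⇒inE {x} l (ev , _) with M x t₀ ≤? double (suc e)
      ... | yes sm = inj₁ sm
      ... | no ¬sm = inj₂ (subst Even (M-large l ¬sm) ev)

      -- `c` is the zero function on `E`. Convergence is doubly negated, as the infinitude of the
      -- actions is.
      Computes-E : ℕ → Set
      Computes-E c = (∀ x → InE x → ¬ ¬ ∃ λ t → v c x t ≡ 1) ×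
                     (∀ x t → v c x t ≢ 0 → v c x t ≡ 1 × InE x)

      InfUsed : ℕ → Set
      InfUsed c = ∀ T → ¬ ¬ ∃ λ t → T ≤ t × double e < a t × Exact t c

      infUsed⇒computes-E : ∀ {c} → InfUsed c → Computes-E c
      infUsed⇒computes-E {c} iu = to , from
        where
        to : ∀ x → InE x → ¬ ¬ ∃ λ t → v c x t ≡ 1
        -- A round starting no earlier than `x` ends with an even action that puts `x` into the
        -- active set for good; `c` is exact at some later stage.
        to x h none = inf-round (x ⊔ t₀) (m≤n⊔m x t₀) λ (t₁ , t₂ , l , t₁<t₂ , _ , even , _) →
          iu (suc t₂) λ (t , t₂<t , _ , ex) →
          let l₂ = ≤-trans l (<⇒≤ t₁<t₂)
              x≤t₂ = ≤-trans (m≤m⊔n x t₀) l₂ in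
          none (t , proj₁ (ex x (≤-<-trans x≤t₂ t₂<t))
            (inE⇒inP (≤-trans (m≤n⊔m x t₀) l₂) even x≤t₂ t₂<t h))
        from : ∀ x s → v c x s ≢ 0 → v c x s ≡ 1 × InE x
        from x s nz = decidable-stable ((v c x s ≟ 1) ×-dec inE? x) λ none →
          iu (suc x ⊔ (t₀ ⊔ s)) λ (t , l , _ , ex) →
          let x<t = ≤-trans (m≤m⊔n (suc x) (t₀ ⊔ s)) l
              r = ≤-trans (m≤n⊔m (suc x) _) l
              t₀≤t = ≤-trans (m≤m⊔n t₀ s) r
              s≤t = ≤-trans (m≤n⊔m t₀ s) r in
          go t t₀≤t s≤t (ex x x<t) none
          where
          go : ∀ t → t₀ ≤ t → s ≤ t → (InP t 0 x → v c x t ≡ 1) × (¬ InP t 0 x → v c x t ≡ 0) →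
               ¬ ¬ (v c x s ≡ 1 × InE x)
          go t t₀≤t s≤t (pos , neg) none with v c x s in eq
          ... | zero = nz refl
          ... | suc y with inP? t 0 x
          ... | no ¬p with () ← trans (sym (v-mono c x s≤t eq)) (neg ¬p)
          ... | yes p = none (trans (sym (v-mono c x s≤t eq)) (pos p) , inP⇒inE t₀≤t p)

      mn : ℕ → ℕ
      mn c = F c (ix c)

      computes-E⇒same : ∀ {c c′} → Computes-E c → Computes-E c′ →
        ∀ x t y → v c x t ≡ suc y → ¬ ¬ ∃ λ t′ → v c′ x t′ ≡ suc y
      computes-E⇒same {c} (_ , from) (to , _) x t y eq
        with from x t (λ z → 1+n≢0 (trans (sym eq) z))
      ... | one , h with refl ← suc-injective (trans (sym one) eq) = to x h

      mn-computes-E : ∀ {c} → Computes-E c → Computes-E (mn c)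
      mn-computes-E {c} (to , from) =
          (λ x h none → to x h λ (t , eq) → none (min-from c eq)) , from′
        where
        from′ : ∀ x t → v (mn c) x t ≢ 0 → v (mn c) x t ≡ 1 × InE x
        from′ x t nz with v (mn c) x t in eq
        ... | zero  = ⊥-elim (nz refl)
        ... | suc y with min-to c eq
        ... | s , eq′ with from x s (λ z → 1+n≢0 (trans (sym eq′) z))
        ... | one , h = trans (sym eq′) one , h

      Settled : ℕ → ℕ → Set
      Settled T c = InfUsed c ⊎ (∀ t → T ≤ t → double e < a t → ¬ Exact t c)

      -- Excluded middle under a double negation: if no `T` serves for `inj₂`, then `InfUsed c`
      -- holds.
      settle-one : ∀ c → ¬ ¬ ∃ λ T → Settled T c
      settle-one c none = none (0 , inj₁ λ T none′ →
        none (T , inj₂ λ t l act ex → none′ (t , l , act , ex)))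

      settled-mono : ∀ {T T′ c} → T ≤ T′ → Settled T c → Settled T′ c
      settled-mono l (inj₁ iu) = inj₁ iu
      settled-mono l (inj₂ un) = inj₂ λ t T′≤t → un t (≤-trans l T′≤t)

      settle : ∀ n → ¬ ¬ ∃ λ T → ∀ c → c < n → Settled T c
      settle zero    none = none (0 , λ c ())
      settle (suc n) none = settle n λ (T , all) → settle-one n λ (T′ , one) →
        none (T ⊔ T′ , λ c c<n → step T T′ all one c (m≤n⇒m<n∨m≡n (≤-pred c<n)))
        where
        step : ∀ T T′ → (∀ c → c < n → Settled T c) → Settled T′ n → ∀ c → c < n ⊎ c ≡ n → Settled (T ⊔ T′) c
        step T T′ all one c (inj₁ l)    = settled-mono (m≤m⊔n T T′) (all c l)
        step T T′ all one c (inj₂ refl) = settled-mono (m≤n⊔m T T′) one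

      -- The point `t₀` witnesses `Out`: later actions do not exceed `double (suc e)`, so it never
      -- enters the base of level `suc e`. `Live` holds because `E` lies within `InU t (suc e)`.
      cond-late : ∀ {c t T} → Computes-E c → v c t₀ T ≡ 1 → T ≤ t → t₀ < t → Cond t (suc e) c
      cond-late {c} {t} (_ , from) seen T≤t t₀<t = live ,
          (t₀ , t₀<t , (λ z → 1+n≢0 (trans (sym (v-mono c t₀ T≤t seen)) z)) ,
            λ (_ , l) → <⇒≱ l (M-small (<⇒≤ t₀<t) (≤-trans (≤-reflexive (M-zero ≤-refl)) z≤n)))
        where
        live : Live t (suc e) c
        live x _ with v c x t ≟ 0
        ... | yes z = inj₁ z
        ... | no nz = let one , h = from x t nz in inj₂ (one , inE⇒inU (<⇒≤ t₀<t) h)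

      -- A point shown outside the base at t₁ is still shown at t₂, but it was available
      -- before t₁ and so is excluded from the right subtree.
      round-excludes : ∀ {t₁ t₂ c} → Round t₁ t₂ → Cond t₁ e c → Cond t₂ e c → ⊥
      round-excludes {t₁} {t₂} {c} (t₁<t₂ , odd , _ , quiet) (_ , x , x<t₁ , nz , ¬p) (live , _)
        with v c x t₁ in eq | live x (<-trans x<t₁ t₁<t₂)
      ... | zero  | _ = nz refl
      ... | suc y | inj₁ z with () ← trans (sym (v-mono c x (<⇒≤ t₁<t₂) eq)) z
      ... | suc y | inj₂ (_ , inj₁ sm) =
        <⇒≱ (≤-reflexive (sym odd)) (≤-trans (M-ub (<⇒≤ x<t₁) t₁<t₂) sm)
      ... | suc y | inj₂ (_ , inj₂ ev) = ¬p (subst Even same ev , subst (double e <_) same big)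
        where
        big : double e < M x t₂
        big = ≤-trans (≤-reflexive (sym odd)) (M-ub (<⇒≤ x<t₁) t₁<t₂)
        rest : M t₁ t₂ ≤ suc (double e)
        rest = M-lub t₁ t₂ λ s t₁≤s s<t₂ → below s s<t₂ (m≤n⇒m<n∨m≡n t₁≤s)
          where
          below : ∀ s → s < t₂ → t₁ < s ⊎ t₁ ≡ s → a s ≤ suc (double e)
          below s s<t₂ (inj₁ l)    = m≤n⇒m≤1+n (quiet s l s<t₂)
          below s s<t₂ (inj₂ refl) = ≤-reflexive odd
        same : M x t₂ ≡ M x t₁
        same with ⊔-sel (M t₁ t₂) (M x t₁)
        ... | inj₂ s = trans (M-split (<⇒≤ x<t₁) (<⇒≤ t₁<t₂)) s
        ... | inj₁ s = ⊥-elim (odd-not-even e (subst Even (≤-antisym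
                (≤-trans (≤-reflexive eq′) rest) big) ev))
          where
          eq′ : M x t₂ ≡ M t₁ t₂
          eq′ = trans (M-split (<⇒≤ x<t₁) (<⇒≤ t₁<t₂)) s

      -- As there are finitely many tokens, one bound covers all slots ever used, and `settle`
      -- yields one stage for all of them.
      G = proj₁ (B-bound Λ)

      used≤G : ∀ {t c} → Used t e c → c ≤ G
      used≤G {t} (c≤ , _) = ≤-trans c≤ (proj₂ (B-bound Λ) (tok t) (tok<Λ t))

      absurd : ⊥
      absurd = settle (suc G) λ (T , settled) → inf (T ⊔ t₀) λ (t , l , act) →
        let c , u = used (≤-trans (m≤n⊔m T t₀) l) act
            ce = computes T settled t (≤-trans (m≤m⊔n T t₀) l) act c u
            cm = mn-computes-E ce in
        -- The point `t₀` lies in `E`, its maximum at `t₀` being taken over an empty interval.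
        proj₁ cm t₀ (inj₁ (≤-trans (≤-reflexive (M-zero ≤-refl)) z≤n)) λ (T′ , seen) →
        -- Late enough for the slots to be settled, for the minimal index to show `t₀`, and for `t₀`
        -- to be available.
        inf-round (T ⊔ (T′ ⊔ suc t₀)) (≤-trans (n≤1+n t₀) (≤-trans (m≤n⊔m T′ _) (m≤n⊔m T _)))
          λ (t₁ , t₂ , l₁ , r) →
        let t₁<t₂ = proj₁ r
            odd   = proj₁ (proj₂ r)
            even  = proj₁ (proj₂ (proj₂ r))
            l₂    = ≤-trans l₁ (<⇒≤ t₁<t₂) in
        round-excludes r
          (lower T settled c ce T′ seen t₁ l₁ (≤-reflexive (sym odd)) (proj₂ (odd-action odd)))
          (lower T settled c ce T′ seen t₂ l₂ (≤-trans (n≤1+n _) (≤-reflexive (sym even)))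
            (proj₂ (even-action even)))
        where
        computes : ∀ T → (∀ c → c < suc G → Settled T c) → ∀ t → T ≤ t → double e < a t →
          ∀ c → Used t e c → Computes-E c
        computes T settled t T≤t act c u with settled c (s≤s (used≤G u))
        ... | inj₁ iu = infUsed⇒computes-E iu
        ... | inj₂ un = ⊥-elim (un t T≤t act (proj₁ (proj₂ u)))
        -- The slot used at `t` may differ from `c`, but it computes `E` too; so its minimal index
        -- is `mn c`, which is thus a candidate to which `Good` applies.
        lower : ∀ T → (∀ c → c < suc G → Settled T c) → ∀ c → Computes-E c →
          ∀ T′ → v (mn c) t₀ T′ ≡ 1 → ∀ t → T ⊔ (T′ ⊔ suc t₀) ≤ t → double e < a t →
          ∃ (Used t e) → Cond t e (mn c)
        lower T settled c ce T′ seen t l act (c′ , u) =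
          subst (Cond t e) same (proj₂ (proj₂ u) (ix c′) (subst (Cond t (suc e)) (sym same)
            (cond-late (mn-computes-E ce) seen
              (≤-trans (m≤m⊔n T′ _) l′) (≤-trans (m≤n⊔m T′ _) l′))))
          where
          l′ = ≤-trans (m≤n⊔m T _) l
          ce′ = computes T settled t (≤-trans (m≤m⊔n T _) l) act c′ u
          same : mn c′ ≡ mn c
          same = min-unique c′ c (computes-E⇒same ce′ ce) (computes-E⇒same ce ce′)

    -- The highest level acting infinitely often is not determined; a bound on late actions is
    -- lowered instead. Once all levels above `n` have stopped, level `n` cannot stop, by induction,
    -- and `Level.absurd` refutes that it goes on.
    descend : ∀ n → Eventually≤ (double n) → ⊥
    descend zero    ev = not-stuck ev
    descend (suc n) (t₀ , late) = Level.absurd n t₀ late λ T none →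
      descend n (T , λ t T≤t → ≮⇒≥ λ l → none (t , T≤t , l))

    contradictory : ⊥
    contradictory = descend D (0 , λ t _ → a≤ t)

-- The strategy as a program

⇓*-deterministic : (ps : Vec (PR n) m) → ∀ {ρ ys zs} → ps ⟦ ρ ⟧⇓* ys → ps ⟦ ρ ⟧⇓* zs → ys ≡ zs
⇓*-deterministic []       []       []         = refl
⇓*-deterministic (p ∷ ps) (d ∷ ds) (d′ ∷ ds′) =
  cong₂ _∷_ (⇓-deterministic p d d′) (⇓*-deterministic ps ds ds′)

computable⇒comp : {f : ℕ → ℕ} → Computable f → Comp {1} (λ ρ → f (head ρ))
computable⇒comp (p , d) = mkComp p (λ { (x ∷ []) → d x })

comp-⇔ : (p : PR m) {G : Vec ℕ n → Vec ℕ m} (cs : Comps G) → ∀ ρ y →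
  (comp p (codes cs) ⟦ ρ ⟧⇓ y) ⇔ (p ⟦ G ρ ⟧⇓ y)
comp-⇔ p {G} cs ρ y = mk⇔ to (compE (evals cs ρ))
  where
  to : comp p (codes cs) ⟦ ρ ⟧⇓ y → p ⟦ G ρ ⟧⇓ y
  to (compE {ys = ys} ds d) = subst (λ zs → p ⟦ zs ⟧⇓ y) (⇓*-deterministic (codes cs) ds (evals cs ρ)) d

mu-sound : {P : Vec ℕ (suc n) → Set} (r : Rec P) → ∀ ρ {y} → mu (code (χ-comp r)) ⟦ ρ ⟧⇓ y → P (y ∷ ρ)
mu-sound {P = P} r ρ (muE d) = go d
  where
  go : ∀ {i y} → MuFrom (code (χ-comp r)) ρ i y → P (y ∷ ρ)
  go (here d)    = sound r _ (⇓-deterministic (code (χ-comp r)) (eval (χ-comp r) _) d)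
  go (there _ d) = go d

-- The search counts up from 0 with `d` steps left before `t`; it may stop at an earlier zero.
mu-complete : {P : Vec ℕ (suc n) → Set} (r : Rec P) → ∀ ρ {t} → P (t ∷ ρ) →
  ∃ λ y → mu (code (χ-comp r)) ⟦ ρ ⟧⇓ y
mu-complete r ρ {t} Pt = let y , d = go t 0 (+-identityʳ t) in y , muE d
  where
  go : ∀ d i → d + i ≡ t → ∃ (MuFrom (code (χ-comp r)) ρ i)
  go d i eq with χ r (i ∷ ρ) in e
  go d i eq | zero = i , here (subst (code (χ-comp r) ⟦ i ∷ ρ ⟧⇓_) e (eval (χ-comp r) (i ∷ ρ)))
  go zero i refl | suc z with () ← trans (sym e) (complete r (i ∷ ρ) Pt)
  go (suc d) i eq | suc z = let y , rest = go d (suc i) (trans (+-suc d i) eq) in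
    y , there (subst (code (χ-comp r) ⟦ i ∷ ρ ⟧⇓_) e (eval (χ-comp r) (i ∷ ρ))) rest

same-sym : ∀ {φ ψ i j} → SameFn φ i ψ j → SameFn ψ j φ i
same-sym s x y = mk⇔ (Equivalence.from (s x y)) (Equivalence.to (s x y))

same-trans : ∀ {φ ψ χ i j l} → SameFn φ i ψ j → SameFn ψ j χ l → SameFn φ i χ l
same-trans s s′ x y = mk⇔ (Equivalence.to (s′ x y) ∘ Equivalence.to (s x y))
                          (Equivalence.from (s x y) ∘ Equivalence.from (s′ x y))

const-comps : (ρ : Vec ℕ m) → Comps {n} (λ _ → ρ)
const-comps []      = nil
const-comps (x ∷ ρ) = const-comp x ,, const-comps ρ

parity-suc : ∀ n → parity (suc n) ≡ 1 ∸ parity n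
parity-suc zero          = refl
parity-suc (suc zero)    = refl
parity-suc (suc (suc n)) = parity-suc n

parity-comp : Comp f → Comp (λ ρ → parity (f ρ))
parity-comp {f = f} cf = comp-ext (λ ρ → lem (f ρ))
  (comp-natrec (const-comp 0) (∸-comp (const-comp 1) (var (suc zero))) cf)
  where
  lem : ∀ n → natrec 0 (λ _ a → 1 ∸ a) n ≡ parity n
  lem zero    = refl
  lem (suc n) = trans (cong (1 ∸_) (lem n)) (sym (parity-suc n))

double-comp : Comp f → Comp (λ ρ → double (f ρ))
double-comp {f = f} cf = comp-ext (λ ρ → lem (f ρ))
  (comp-natrec (const-comp 0) (suc-comp (suc-comp (var (suc zero)))) cf)
  where
  lem : ∀ n → natrec 0 (λ _ a → suc (suc a)) n ≡ double n
  lem zero    = refl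
  lem (suc n) = cong (λ z → suc (suc z)) (lem n)

-- A history is the nested pairing of all earlier actions, the most recent one outermost.
peel : ℕ → ℕ → ℕ
peel i L = natrec L (λ _ z → snd z) i

recent-max : ℕ → ℕ → ℕ
recent-max n L = natrec 0 (λ i a → a ⊔ fst (peel i L)) n

peel-pair : ∀ i x L → peel (suc i) (pair x L) ≡ peel i L
peel-pair zero    x L = snd-pair x L
peel-pair (suc i) x L = cong snd (peel-pair i x L)

recent-max-pair : ∀ n x L → recent-max (suc n) (pair x L) ≡ x ⊔ recent-max n L
recent-max-pair zero    x L = trans (fst-pair x L) (sym (⊔-identityʳ x))
recent-max-pair (suc n) x L = trans
  (cong₂ _⊔_ (recent-max-pair n x L) (cong fst (peel-pair n x L)))
  (⊔-assoc x (recent-max n L) (fst (peel n L)))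

peel-comp : Comp f → Comp g → Comp (λ ρ → peel (f ρ) (g ρ))
peel-comp cf cg = comp-natrec cg (snd-comp (var (suc zero))) cf

recent-max-comp : Comp f → Comp g → Comp (λ ρ → recent-max (f ρ) (g ρ))
recent-max-comp cf cg = comp-natrec (const-comp 0)
  (⊔-comp (var (suc zero)) (fst-comp (peel-comp (var zero) (wk (wk cg))))) cf

-- At stage `t` the `t ∸ x` most recent actions are those at the stages in `[x, t)`; there are none
-- for `x ≥ t`.
snapshot : ℕ → ℕ → ℕ → ℕ
snapshot t L x = recent-max (t ∸ x) L

-- A higher level has a smaller base and a larger `InU`, so both halves of `Cond` become weaker.
cond-mono : ∀ v {k} (F : ℕ → Fin k → ℕ) m t {e e′ c} → e ≤ e′ →
  Snapshot.Cond v F m t e c → Snapshot.Cond v F m t e′ c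
cond-mono v F m t {e} {e′} {c} l (live , x , x<t , nz , ¬p) =
    (λ y y<t → go y (live y y<t)) , x , x<t , nz , λ (ev , big) → ¬p (ev , ≤-<-trans (double-mono l) big)
  where
  go : ∀ y → v c y t ≡ 0 ⊎ (v c y t ≡ 1 × Snapshot.InU v F m t e y) →
       v c y t ≡ 0 ⊎ (v c y t ≡ 1 × Snapshot.InU v F m t e′ y)
  go y (inj₁ z)              = inj₁ z
  go y (inj₂ (o , inj₁ sm)) = inj₂ (o , inj₁ (≤-trans sm (double-mono l)))
  go y (inj₂ (o , inj₂ ev)) = inj₂ (o , inj₂ ev)

-- A level `e` that is not good has a candidate counting at `suc e` but not at `e`. If all `suc k`
-- levels failed, two would share one of the `k` candidates, contrary to `cond-mono`.
good-exists : ∀ v {k} (F : ℕ → Fin k → ℕ) m t c →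
  (∀ e c → Dec (Snapshot.Cond v F m t e c)) → ∃< (suc k) λ e → Snapshot.Good v F m t e c
good-exists v {k} F m t c cond? with Fin.any? (λ (e : Fin (suc k)) → Fin.all? (imp? (toℕ e)))
  where
  imp? : ∀ e i → Dec (Snapshot.Cond v F m t (suc e) (F c i) → Snapshot.Cond v F m t e (F c i))
  imp? e i = cond? (suc e) (F c i) →-dec cond? e (F c i)
... | yes (e , good) = toℕ e , Fin.toℕ<n e , good
... | no none = ⊥-elim (clash (Fin.pigeonhole (n<1+n k) (proj₁ ∘ escapes)))
  where
  imp? : ∀ e i → Dec (Snapshot.Cond v F m t (suc e) (F c i) → Snapshot.Cond v F m t e (F c i))
  imp? e i = cond? (suc e) (F c i) →-dec cond? e (F c i)
  escapes : (e : Fin (suc k)) → ∃ λ i → ¬ (Snapshot.Cond v F m t (suc (toℕ e)) (F c i) →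
                                            Snapshot.Cond v F m t (toℕ e) (F c i))
  escapes e = Fin.¬∀⟶∃¬ k _ (imp? (toℕ e)) (λ all → none (e , all))
  clash : ¬ ∃₂ λ i j → i Data.Fin.< j × proj₁ (escapes i) ≡ proj₁ (escapes j)
  clash (e , e′ , l , eq) = proj₂ (escapes e′) λ _ → ⊥-elim (proj₂ (escapes e) λ cond →
    ⊥-elim (proj₂ (escapes e′) λ _ →
      subst (Snapshot.Cond v F m t (toℕ e′) ∘ F c) eq (cond-mono v F m t l cond)))

module Strategy (φ : Numbering) {k : ℕ} (F : ℕ → Fin k → ℕ)
  (F-comp₁ : ∀ i → Comp {1} (λ ρ → F (head ρ) i))
  (b : ℕ → ℕ) (b-comp₁ : Comp {1} (λ ρ → b (head ρ))) where

  D : ℕ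
  D = suc k

  v : ℕ → ℕ → ℕ → ℕ
  v c x t = stage φ t (c ∷ x ∷ [])

  module S (t L : ℕ) = Snapshot v F (snapshot t L) t

  v-comp : Comp f → Comp g → Comp h → Comp (λ ρ → v (f ρ) (g ρ) (h ρ))
  v-comp cc cx ct = stage-comp φ ct (cc ,, cx ,, nil)

  F-comp : ∀ i → Comp f → Comp (λ ρ → F (f ρ) i)
  F-comp i cf = F-comp₁ i ∘ᶜ (cf ,, nil)

  b-comp : Comp f → Comp (λ ρ → b (f ρ))
  b-comp cf = b-comp₁ ∘ᶜ (cf ,, nil)

  private variable
    T L E X C : Vec ℕ n → ℕ

  snapshot-comp : Comp T → Comp L → Comp X → Comp (λ ρ → snapshot (T ρ) (L ρ) (X ρ))
  snapshot-comp ct cl cx = recent-max-comp (∸-comp ct cx) cl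

  inP-rec : Comp T → Comp L → Comp E → Comp X → Rec (λ ρ → S.InP (T ρ) (L ρ) (E ρ) (X ρ))
  inP-rec ct cl ce cx = rec-× (rec-≡ (parity-comp (snapshot-comp ct cl cx)) (const-comp 0))
    (rec-< (double-comp ce) (snapshot-comp ct cl cx))

  inU-rec : Comp T → Comp L → Comp E → Comp X → Rec (λ ρ → S.InU (T ρ) (L ρ) (E ρ) (X ρ))
  inU-rec ct cl ce cx = rec-⊎ (rec-≤ (snapshot-comp ct cl cx) (double-comp ce))
    (rec-≡ (parity-comp (snapshot-comp ct cl cx)) (const-comp 0))

  exact-rec : Comp T → Comp L → Comp C → Rec (λ ρ → S.Exact (T ρ) (L ρ) (C ρ))
  exact-rec ct cl cc = rec-∀< ct
    (rec-× (rec-→ inP (rec-≡ val (const-comp 1))) (rec-→ (rec-¬ inP) (rec-≡ val (const-comp 0))))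
    where
    inP = inP-rec (wk ct) (wk cl) (const-comp 0) head-comp
    val = v-comp (wk cc) head-comp (wk ct)

  cond-rec : Comp T → Comp L → Comp E → Comp C → Rec (λ ρ → S.Cond (T ρ) (L ρ) (E ρ) (C ρ))
  cond-rec ct cl ce cc = rec-×
    (rec-∀< ct (rec-⊎ (rec-≡ val (const-comp 0))
      (rec-× (rec-≡ val (const-comp 1)) (inU-rec (wk ct) (wk cl) (wk ce) head-comp))))
    (rec-∃< ct (rec-× (rec-¬ (rec-≡ val (const-comp 0)))
      (rec-¬ (inP-rec (wk ct) (wk cl) (wk ce) head-comp))))
    where
    val = v-comp (wk cc) head-comp (wk ct)

  good-rec : Comp T → Comp L → Comp E → Comp C → Rec (λ ρ → S.Good (T ρ) (L ρ) (E ρ) (C ρ))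
  good-rec ct cl ce cc = rec-∀Fin λ i →
    rec-→ (cond-rec ct cl (suc-comp ce) (F-comp i cc)) (cond-rec ct cl ce (F-comp i cc))

  right-rec : Comp T → Comp L → Comp E → Rec (λ ρ → S.Right (T ρ) (L ρ) (E ρ))
  right-rec ct cl ce =
    rec-∃< ct (rec-≡ (snapshot-comp (wk ct) (wk cl) head-comp) (suc-comp (double-comp (wk ce))))

  opaque
    exact? : ∀ t L c → Dec (S.Exact t L c)
    exact? t L c = rec-dec (exact-rec (var zero) (var (suc zero)) (var (suc (suc zero)))) (t ∷ L ∷ c ∷ [])

    cond? : ∀ t L e c → Dec (S.Cond t L e c)
    cond? t L e c = rec-dec (cond-rec (var zero) (var (suc zero)) (var (suc (suc zero)))
      (var (suc (suc (suc zero))))) (t ∷ L ∷ e ∷ c ∷ [])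

    good? : ∀ t L e c → Dec (S.Good t L e c)
    good? t L e c = rec-dec (good-rec (var zero) (var (suc zero)) (var (suc (suc zero)))
      (var (suc (suc (suc zero))))) (t ∷ L ∷ e ∷ c ∷ [])

    right? : ∀ t L e → Dec (S.Right t L e)
    right? t L e = rec-dec (right-rec (var zero) (var (suc zero)) (var (suc (suc zero)))) (t ∷ L ∷ e ∷ [])

  bit : ℕ → ℕ → ℕ → ℕ
  bit t L e = ifd (right? t L e) 1 0

  -- The active token, coded by the sides on which the levels below n are playing.
  token : ℕ → ℕ → ℕ → ℕ
  token t L = natrec 0 (λ e s → double s + bit t L e)

  module _ (A t L : ℕ) where
    bound slot level action : ℕ
    -- `search` looks strictly below its bound, hence the `suc`; the result `bound` means that no
    -- slot is exact, and then `step` waits.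
    bound  = suc (b (pair A (token t L D)))
    slot   = search (exact? t L) bound
    level  = search (λ e → good? t L e slot) D
    action = ifd (right? t L level) (double (suc level)) (suc (double level))

    step : ℕ
    step = ifd (slot <? bound) action 0

  token-comp : Comp T → Comp L → Comp (λ ρ → token (T ρ) (L ρ) D)
  token-comp {T = T} {L = L} ct cl = comp-natrec (const-comp 0)
    (+-comp (double-comp (var (suc zero)))
      (ifd-comp (right-rec (wk (wk ct)) (wk (wk cl)) (var zero))
        (λ ρ → right? (T (tail (tail ρ))) (L (tail (tail ρ))) (lookup ρ zero)) (const-comp 1) (const-comp 0)))
    (const-comp D)

  bound-comp : Comp f → Comp T → Comp L → Comp (λ ρ → bound (f ρ) (T ρ) (L ρ))
  bound-comp ca ct cl = suc-comp (b-comp (pair-comp ca (token-comp ct cl)))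

  slot-comp : Comp f → Comp T → Comp L → Comp (λ ρ → slot (f ρ) (T ρ) (L ρ))
  slot-comp {T = T} {L = L} ca ct cl =
    search-comp (exact-rec (wk ct) (wk cl) head-comp) (λ ρ → exact? (T ρ) (L ρ)) (bound-comp ca ct cl)

  level-comp : Comp f → Comp T → Comp L → Comp (λ ρ → level (f ρ) (T ρ) (L ρ))
  level-comp {f = A} {T = T} {L = L} ca ct cl =
    search-comp (good-rec (wk ct) (wk cl) head-comp (wk (slot-comp ca ct cl)))
      (λ ρ e → good? (T ρ) (L ρ) e (slot (A ρ) (T ρ) (L ρ))) (const-comp D)

  step-comp : Comp f → Comp T → Comp L → Comp (λ ρ → step (f ρ) (T ρ) (L ρ))
  step-comp {f = A} {T = T} {L = L} ca ct cl =
    ifd-comp (rec-< (slot-comp ca ct cl) (bound-comp ca ct cl))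
      (λ ρ → slot (A ρ) (T ρ) (L ρ) <? bound (A ρ) (T ρ) (L ρ))
      (ifd-comp (right-rec ct cl lev) (λ ρ → right? (T ρ) (L ρ) (level (A ρ) (T ρ) (L ρ)))
        (double-comp (suc-comp lev)) (suc-comp (double-comp lev)))
      (const-comp 0)
    where
    lev = level-comp ca ct cl

  history : ℕ → ℕ → ℕ
  history A = natrec 0 (λ t L → pair (step A t L) L)

  history-comp : Comp f → Comp T → Comp (λ ρ → history (f ρ) (T ρ))
  history-comp ca ct = comp-natrec (const-comp 0)
    (pair-comp (step-comp (wk (wk ca)) (var zero) (var (suc zero))) (var (suc zero))) ct

  -- The function of token `l` lives on the union of the active sets over all stages at which `l` is
  -- active, in the play with index `A`.
  InToken : ℕ → ℕ → ℕ → ℕ → Set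
  InToken A l x t = token t (history A t) D ≡ l × S.InP t (history A t) 0 x

  inToken-rec : Comp f → Comp g → Comp X → Comp T → Rec (λ ρ → InToken (f ρ) (g ρ) (X ρ) (T ρ))
  inToken-rec ca cl cx ct = rec-× (rec-≡ (token-comp ct (history-comp ca ct)) cl)
    (inP-rec ct (history-comp ca ct) (const-comp 0) cx)

  -- `2 ^ n`, one token for each choice of sides at `n` levels.
  Λ : ℕ → ℕ
  Λ zero    = 1
  Λ (suc n) = double (Λ n)

  bit≤1 : ∀ t L e → bit t L e ≤ 1
  bit≤1 t L e with right? t L e
  ... | yes _ = ≤-refl
  ... | no _  = z≤n

  token<Λ : ∀ t L n → token t L n < Λ n
  token<Λ t L zero    = ≤-refl
  token<Λ t L (suc n) = begin-strict
    double (token t L n) + bit t L n  ≤⟨ +-monoʳ-≤ (double (token t L n)) (bit≤1 t L n) ⟩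
    double (token t L n) + 1          ≡⟨ +-comm (double (token t L n)) 1 ⟩
    suc (double (token t L n))        <⟨ n<1+n _ ⟩
    double (suc (token t L n))        ≤⟨ double-mono (token<Λ t L n) ⟩
    double (Λ n)                      ∎
    where open ≤-Reasoning

  -- Uniqueness of binary expansions: the lowest bit belongs to the highest level, and parity
  -- separates its two values.
  token-right : ∀ n {t L t′ L′} → token t L n ≡ token t′ L′ n →
    ∀ e → e < n → S.Right t L e → S.Right t′ L′ e
  token-right (suc n) {t} {L} {t′} {L′} eq e e<n r
    with right? t L n | right? t′ L′ n | m≤n⇒m<n∨m≡n (≤-pred e<n)
  ... | yes _ | yes r′ | inj₂ refl = r′
  ... | no ¬r | _      | inj₂ refl = ⊥-elim (¬r r)
  ... | yes _ | yes _  | inj₁ l = token-right n {t} {L} (double-injective (+-cancelʳ-≡ 1 _ _ eq)) e l r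
  ... | no _  | no _   | inj₁ l = token-right n {t} {L} (double-injective (+-cancelʳ-≡ 0 _ _ eq)) e l r
  ... | yes _ | no _   | _ = ⊥-elim (double≢odd (trans (sym (+-identityʳ _)) (trans (sym eq) (+-comm _ 1))))
  ... | no _  | yes _  | inj₁ _ = ⊥-elim (double≢odd (trans (sym (+-identityʳ _)) (trans eq (+-comm _ 1))))

  right-token : ∀ n {t L t′ L′} → (∀ e → e < n → S.Right t L e → S.Right t′ L′ e) →
    (∀ e → e < n → S.Right t′ L′ e → S.Right t L e) → token t L n ≡ token t′ L′ n
  right-token zero    to from = refl
  right-token (suc n) {t} {L} {t′} {L′} to from =
    cong₂ (λ s β → double s + β)
      (right-token n (λ e l → to e (m≤n⇒m≤1+n l)) (λ e l → from e (m≤n⇒m≤1+n l))) bits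
    where
    bits : bit t L n ≡ bit t′ L′ n
    bits with right? t L n | right? t′ L′ n
    ... | yes _ | yes _ = refl
    ... | no _  | no _  = refl
    ... | yes r | no ¬r = ⊥-elim (¬r (to n ≤-refl r))
    ... | no ¬r | yes r = ⊥-elim (¬r (from n ≤-refl r))

  step-spec : ∀ A t L →
    (step A t L ≡ 0 × (∀ c → c ≤ b (pair A (token t L D)) → ¬ S.Exact t L c)) ⊎
    (∃₂ λ e c → e < D × (c ≤ b (pair A (token t L D)) × S.Exact t L c × S.Good t L e c) ×
      ((S.Right t L e × step A t L ≡ double (suc e)) ⊎ (¬ S.Right t L e × step A t L ≡ suc (double e))))
  step-spec A t L with search-spec (exact? t L) (bound A t L)
  ... | inj₂ (e , none) =
    inj₁ (ifd-no (slot A t L <? bound A t L) (λ l → <-irrefl e l) , λ c l → none c (s≤s l))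
  ... | inj₁ (l , ex) =
    inj₂ (level A t L , slot A t L , proj₁ found , (≤-pred l , ex , proj₂ found) ,
          acts (right? t L (level A t L)) (ifd-yes (slot A t L <? bound A t L) l))
    where
    found = search-found (λ e → good? t L e (slot A t L))
              (good-exists v F (snapshot t L) t (slot A t L) (cond? t L))
    acts : ∀ {R : Set} {e z : ℕ} (d : Dec R) → z ≡ ifd d (double (suc e)) (suc (double e)) →
      (R × z ≡ double (suc e)) ⊎ (¬ R × z ≡ suc (double e))
    acts (yes r) eq = inj₁ (r , eq)
    acts (no ¬r) eq = inj₂ (¬r , eq)

-- Contradiction from computable candidates: self-reference and the actual play

module _ (φ : Numbering) (cb : ComputablyBounded φ) {k : ℕ} (f : ℕ → Vec ℕ k) (fc : ComputableVec f)
  (fmin : ∀ e → ∃ λ (i : Fin k) → IsMinIndex φ e (lookup (f e) i)) where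

  F : ℕ → Fin k → ℕ
  F c i = lookup (f c) i

  ix : ℕ → Fin k
  ix c = proj₁ (fmin c)

  min-same : ∀ c → SameFn φ (F c (ix c)) φ c
  min-same c = proj₂ (proj₂ (fmin c))

  -- Numbers can be compared and either strict inequality contradicts minimality, so the doubly
  -- negated hypothesis suffices.
  same⇒min≡ : ∀ c c′ → ¬ ¬ SameFn φ c φ c′ → F c (ix c) ≡ F c′ (ix c′)
  same⇒min≡ c c′ ¬¬s with <-cmp (F c (ix c)) (F c′ (ix c′))
  ... | tri≈ _ eq _ = eq
  ... | tri< l _ _ = ⊥-elim (¬¬s λ s → proj₁ (proj₂ (fmin c′)) _ l
          (same-trans {φ} (min-same c) (same-trans {φ} s (same-sym {φ} (min-same c′)))))
  ... | tri> _ _ l = ⊥-elim (¬¬s λ s → proj₁ (proj₂ (fmin c)) _ l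
          (same-trans {φ} (min-same c′) (same-trans {φ} (same-sym {φ} s) (same-sym {φ} (min-same c)))))

  -- Markov's principle for halting: minimal indices decide whether the function that waits
  -- for p ⟦ ρ ⟧ and then returns 0 equals the zero function.
  halting-stable : (p : PR n) → ∀ ρ y → ¬ ¬ (p ⟦ ρ ⟧⇓ y) → p ⟦ ρ ⟧⇓ y
  halting-stable p ρ y ¬¬d with proj₂ (proj₂ (cb waiting)) 0 | proj₂ (proj₂ (cb zer)) 0
    where
    waiting : PR 2
    waiting = comp {m = 1} zer (comp p (codes (const-comps ρ)) ∷ [])
  ... | i , _ , si | j , _ , sj = extract (Equivalence.to (si 0 0) (Equivalence.from (i≈j 0 0)
            (Equivalence.from (sj 0 0) zerE)))
    where
    waiting : PR 2
    waiting = comp {m = 1} zer (comp p (codes (const-comps ρ)) ∷ [])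
    same-if : p ⟦ ρ ⟧⇓ y → SameFn φ i φ j
    same-if d = same-trans {φ} {waiting} si (same-trans {waiting} {zer} wz (same-sym {φ} {zer} sj))
      where
      wz : SameFn waiting 0 zer 0
      wz x z = mk⇔ (λ { (compE _ zerE) → zerE })
                   (λ { zerE → compE (Equivalence.from (comp-⇔ p (const-comps ρ) _ y) d ∷ []) zerE })
    i≈j : SameFn φ i φ j
    i≈j = same-trans {φ} (same-sym {φ} (min-same i)) (subst (λ c → SameFn φ c φ j)
            (sym (same⇒min≡ i j (λ ¬s → ¬¬d (¬s ∘ same-if)))) (min-same j))
    extract : waiting ⟦ 0 ∷ 0 ∷ [] ⟧⇓ 0 → p ⟦ ρ ⟧⇓ y
    extract (compE (_∷_ {y = z} d []) _) = subst (p ⟦ ρ ⟧⇓_) z≡y d′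
      where
      d′ : p ⟦ ρ ⟧⇓ z
      d′ = Equivalence.to (comp-⇔ p (const-comps ρ) _ z) d
      z≡y : z ≡ y
      z≡y = decidable-stable (z ≟ y) λ z≢y → ¬¬d λ d″ → z≢y (⇓-deterministic p d′ d″)

  diagonal-args : Comps {2} (λ ρ → fst (lookup ρ zero) ∷ pair (lookup ρ zero) (lookup ρ (suc zero)) ∷ [])
  diagonal-args = fst-comp (var zero) ,, pair-comp (var zero) (var (suc zero)) ,, nil

  -- ψ_⟨a,l⟩(x) = φ_a(⟨⟨a,l⟩,x⟩): a φ-index of a program in ⟨⟨a,l⟩,x⟩ hands that program its
  -- own index a, which replaces the recursion theorem.
  ψ : Numbering
  ψ = comp φ (codes diagonal-args)

  b : ℕ → ℕ
  b = proj₁ (cb ψ)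

  F-computable : ∀ i → Comp {1} (λ ρ → F (head ρ) i)
  F-computable i = computable⇒comp (fc i)

  b-computable : Comp {1} (λ ρ → b (head ρ))
  b-computable = computable⇒comp (proj₁ (proj₂ (cb ψ)))

  open Strategy φ F F-computable b b-computable

  InTokenW : Vec ℕ 2 → Set
  InTokenW ρ = InToken (fst (fst w)) (snd (fst w)) (snd w) (lookup ρ zero)
    where w = lookup ρ (suc zero)

  opaque
    token-rec : Rec InTokenW
    token-rec = inToken-rec (fst-comp (fst-comp (var (suc zero)))) (snd-comp (fst-comp (var (suc zero))))
      (snd-comp (var (suc zero))) (var zero)

  -- On `⟨⟨A,l⟩,x⟩` the search halts exactly if `x` is in token `l` at some stage; `zer` then
  -- replaces that stage by 0, so that all tokens are zero functions.
  program : PR 1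
  program = comp {m = 1} zer (mu (code (χ-comp token-rec)) ∷ [])

  program-comps : Comps {2} (λ ρ → lookup ρ (suc zero) ∷ [])
  program-comps = var (suc zero) ,, nil

  opaque
    -- The numbering `comp program (codes program-comps)` has `program` as its only function, so
    -- boundedness at its index 0 yields a `φ`-index of `program`.
    fixed-point : ∃ λ A → SameFn φ A (comp program (codes program-comps)) 0
    fixed-point with proj₂ (proj₂ (cb (comp program (codes program-comps)))) 0
    ... | A , _ , s = A , s

  A : ℕ
  A = proj₁ fixed-point

  InToken-cong : ∀ {A A′ l l′ x x′ t} → A ≡ A′ → l ≡ l′ → x ≡ x′ → InToken A l x t → InToken A′ l′ x′ t
  InToken-cong refl refl refl it = it

  module _ (l x : ℕ) where
    input : ℕ
    input = pair (pair A l) x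

    input₁ : fst (fst input) ≡ A
    input₁ = trans (cong fst (fst-pair (pair A l) x)) (fst-pair A l)

    input₂ : snd (fst input) ≡ l
    input₂ = trans (cong snd (fst-pair (pair A l) x)) (snd-pair A l)

    input₃ : snd input ≡ x
    input₃ = snd-pair (pair A l) x

    program-to : ∀ {y} → program ⟦ input ∷ [] ⟧⇓ y → y ≡ 0 × ∃ (InToken A l x)
    program-to (compE (_∷_ {y = t} d []) zerE) =
      refl , t , InToken-cong {t = t} input₁ input₂ input₃ (mu-sound token-rec (input ∷ []) d)

    program-from : ∀ {t} → InToken A l x t → program ⟦ input ∷ [] ⟧⇓ 0
    program-from {t} it = compE (proj₂ (mu-complete token-rec (input ∷ []) {t}
      (InToken-cong {t = t} (sym input₁) (sym input₂) (sym input₃) it)) ∷ []) zerE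

    -- At `pair A l`, `ψ` runs `φ` with index `A` on `input`, and `A` is an index of `program`.
    -- Hence `b` bounds slots for the very play that `program` simulates.
    ψ⇔program : ∀ y → (ψ ⟦ pair A l ∷ x ∷ [] ⟧⇓ y) ⇔ (program ⟦ input ∷ [] ⟧⇓ y)
    ψ⇔program y = mk⇔
      (λ d → Equivalence.to (comp-⇔ program program-comps _ y) (Equivalence.to (proj₂ fixed-point input y)
        (subst (λ z → φ ⟦ z ∷ input ∷ [] ⟧⇓ y) (fst-pair A l) (Equivalence.to (comp-⇔ φ diagonal-args _ y) d))))
      (λ d → Equivalence.from (comp-⇔ φ diagonal-args _ y)
        (subst (λ z → φ ⟦ z ∷ input ∷ [] ⟧⇓ y) (sym (fst-pair A l))
          (Equivalence.from (proj₂ fixed-point input y)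
            (Equivalence.from (comp-⇔ program program-comps _ y) d))))

  value-to : ∀ c {x t y} → v c x t ≡ suc y → φ ⟦ c ∷ x ∷ [] ⟧⇓ y
  value-to c {x} {t} = stage-sound φ t (c ∷ x ∷ [])

  value-from : ∀ c {x y} → φ ⟦ c ∷ x ∷ [] ⟧⇓ y → ∃ λ t → v c x t ≡ suc y
  value-from c = stage-complete φ

  -- The double negations occur at single arguments; `halting-stable` removes each of them, which
  -- gives `SameFn`.
  min-unique : ∀ c c′ →
    (∀ x t y → v c x t ≡ suc y → ¬ ¬ ∃ λ t′ → v c′ x t′ ≡ suc y) →
    (∀ x t y → v c′ x t ≡ suc y → ¬ ¬ ∃ λ t′ → v c x t′ ≡ suc y) →
    F c (ix c) ≡ F c′ (ix c′)
  min-unique c c′ to from = same⇒min≡ c c′ λ ¬s → ¬s λ x y → mk⇔ (half c c′ to x y) (half c′ c from x y)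
    where
    half : ∀ c c′ → (∀ x t y → v c x t ≡ suc y → ¬ ¬ ∃ λ t′ → v c′ x t′ ≡ suc y) →
      ∀ x y → φ ⟦ c ∷ x ∷ [] ⟧⇓ y → φ ⟦ c′ ∷ x ∷ [] ⟧⇓ y
    half c c′ to x y d = halting-stable φ _ y λ ¬d → let t , eq = value-from c d in
      to x t y eq λ (t′ , eq′) → ¬d (value-to c′ eq′)

  log : ℕ → ℕ
  log t = step A t (history A t)

  M : ℕ → ℕ → ℕ
  M x t = snapshot t (history A t) x

  M-zero : ∀ {x t} → t ≤ x → M x t ≡ 0
  M-zero {x} {t} l = cong (λ n → recent-max n (history A t)) (m≤n⇒m∸n≡0 l)

  M-suc : ∀ {x t} → x ≤ t → M x (suc t) ≡ log t ⊔ M x t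
  M-suc {x} {t} l = trans (cong (λ n → recent-max n (history A (suc t))) (+-∸-assoc 1 l))
    (recent-max-pair (t ∸ x) (log t) (history A t))

  tok : ℕ → ℕ
  tok t = token t (history A t) D

  module _ (l : ℕ) where
    token-index : ∃ λ j → j ≤ b (pair A l) × SameFn φ j ψ (pair A l)
    token-index = proj₂ (proj₂ (cb ψ)) (pair A l)

    token-covered : ∀ j → SameFn φ j ψ (pair A l) → ∀ x t → InToken A l x t → ∃ λ s → v j x s ≡ 1
    token-covered j same x t it = value-from j
      (Equivalence.from (same x 0) (Equivalence.from (ψ⇔program l x 0) (program-from l x {t} it)))

    token-covers : ∀ j → SameFn φ j ψ (pair A l) → ∀ x s → v j x s ≢ 0 → v j x s ≡ 1 × ∃ (InToken A l x)
    token-covers j same x s nz = go (v j x s) refl nz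
      where
      go : ∀ w → v j x s ≡ w → w ≢ 0 → w ≡ 1 × ∃ (InToken A l x)
      go zero    eq nz = ⊥-elim (nz refl)
      go (suc y) eq nz =
        let z , it = program-to l x (Equivalence.to (ψ⇔program l x y)
                       (Equivalence.to (same x y) (value-to j {x} {s} eq)))
        in cong suc z , it

    token-slot : ∃ λ j → j ≤ b (pair A l) ×
      (∀ x t → tok t ≡ l → S.InP t (history A t) 0 x → ∃ λ s → v j x s ≡ 1) ×
      (∀ x s → v j x s ≢ 0 → v j x s ≡ 1 × ∃ λ t → tok t ≡ l × S.InP t (history A t) 0 x)
    token-slot = proj₁ token-index , proj₁ (proj₂ token-index) ,
      (λ x t eq p → token-covered _ (proj₂ (proj₂ token-index)) x t (eq , p)) ,
      token-covers _ (proj₂ (proj₂ token-index))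

  no-candidates : ⊥
  no-candidates = Game.Play.contradictory v (λ c x → stage-mono φ (c ∷ x ∷ [])) F ix
    (λ c eq → value-from c (Equivalence.to (min-same c _ _) (value-to _ eq)))
    (λ c eq → value-from _ (Equivalence.from (min-same c _ _) (value-to c eq)))
    min-unique D log M M-zero M-suc tok (Λ D) (λ t → token<Λ t (history A t) D) (λ l → b (pair A l))
    (λ {t} {t′} → token-right D {t} {history A t} {t′} {history A t′})
    (λ {t} {t′} → right-token D {t} {history A t} {t′} {history A t′})
    (λ t → step-spec A t (history A t)) token-slot

theorem4p3 : (φ : Numbering) → ComputablyBounded φ → (k : ℕ) → 1 ≤ k →
    ¬ (Σ (ℕ → Vec ℕ k) λ f → ComputableVec f ×
    (∀ e → ∃ λ (i : Fin k) → IsMinIndex φ e (lookup (f e) i)))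
theorem4p3 φ cb k _ (f , fc , fmin) = no-candidates φ cb f fc fmin
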